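{- Let $q$ be a prime power and $\nu\ge 1$ an integer. The chromatic number of the symplectic graph $Sp(2\nu,q)$ is $$\chi(Sp(2\nu,q))=q^{\nu}+1.$$
   Context: Let $\mathbb{F}_q$ be the finite field with $q$ elements (any characteristic), and let $\mathbb{F}_q^{(2\nu)}$ be the $2\nu$-dimensional space of row vectors over $\mathbb{F}_q$. Let $K$ be the $2\nu\times 2\nu$ block diagonal matrix over $\mathbb{F}_q$ with $\nu$ diagonal blocks all equal to $\begin{pmatrix}0&1\\-1&0\end{pmatrix}$. For a nonzero row vector $\alpha$, $[\alpha]$ denotes the one-dimensional subspace spanned by $\alpha$. The symplectic graph $Sp(2\nu,q)$ is the simple undirected graph whose vertices are the one-dimensional subspaces of $\mathbb{F}_q^{(2\nu)}$, with $[\alpha]$ adjacent to $[\beta]$ if and only if $\alpha K\,{}^t\!\beta\neq 0$ (where ${}^t\!\beta$ is the transpose of $\beta$). -}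

module Defs where

open import Level using (_⊔_) renaming (suc to lsuc)
open import Algebra.Apartness using (HeytingField)
open import Algebra.Apartness.Bundles using (module HeytingCommutativeRing)
open import Algebra.Bundles using (CommutativeRing)
open import Data.Bool.Base using (if_then_else_)
open import Data.Fin.Base using (Fin; zero; suc; quotient; remainder)
open import Data.Fin.Patterns using (0F; 1F)
open import Data.Fin.Properties using (_≟_)
open import Data.Nat.Base as ℕ using (ℕ; zero; suc)
open import Data.Nat.Primality using (Prime)
open import Data.Product.Base using (Σ-syntax; ∃-syntax; _×_; _,_; proj₁)
open import Data.Vec.Functional using (Vector)
open import Function.Base using (_∘_)
open import Function.Bundles using (Func; Inverse)
open import Relation.Binary.Bundles using (Setoid)
open import Relation.Binary.Core using (Rel)
open import Relation.Binary.Definitions using (Symmetric; _Respects₂_)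
import Relation.Binary.Construct.On as On
open import Relation.Binary.PropositionalEquality.Core as ≡ using (_≡_)
import Relation.Binary.PropositionalEquality.Properties as ≡
open import Relation.Nullary.Decidable.Core using (does; yes; no)
open import Relation.Nullary.Negation.Core using (¬_; contradiction)
open import Relation.Unary using (Pred)
open import Relation.Unary.Relation.Binary.Equality using (≐-setoid)

IsPrimePower : ℕ → Set
IsPrimePower q = ∃[ p ] ∃[ k ] (Prime p × 1 ℕ.≤ k × q ≡ p ℕ.^ k)

HasCardinality : ∀ {c ℓ} → Setoid c ℓ → ℕ → Set (c ⊔ ℓ)
HasCardinality S n = Inverse S (≡.setoid (Fin n))

-- Vertices form a setoid because those of the symplectic graph are
-- represented by spanning vectors.

record SimpleGraph v e r : Set (lsuc (v ⊔ e ⊔ r)) where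
  field
    vertices   : Setoid v e
  open Setoid vertices using (_≈_) renaming (Carrier to Vertex) public
  field
    Adj        : Rel Vertex r
    Adj-resp   : Adj Respects₂ _≈_
    Adj-sym    : Symmetric Adj
    Adj-irrefl : ∀ {x} → ¬ Adj x x

module _ {v e r} (G : SimpleGraph v e r) where
  open SimpleGraph G

  Colourable : ℕ → Set (v ⊔ e ⊔ r)
  Colourable k = Σ[ f ∈ Func vertices (≡.setoid (Fin k)) ]
    (∀ {x y} → Adj x y → ¬ Func.to f x ≡ Func.to f y)

  IsChromaticNumber : ℕ → Set (v ⊔ e ⊔ r)
  IsChromaticNumber χ = Colourable χ × (∀ k → Colourable k → χ ℕ.≤ k)

-- In a Heyting field the apartness x # y is equivalent to invertibility
-- of x - y and is tight, so a finite Heyting field is a field in the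
-- classical sense.

fieldSetoid : ∀ {c ℓ₁ ℓ₂} → HeytingField c ℓ₁ ℓ₂ → Setoid c ℓ₁
fieldSetoid F = CommutativeRing.setoid
  (HeytingCommutativeRing.commutativeRing (HeytingField.heytingCommutativeRing F))

module Symplectic {c ℓ₁ ℓ₂} (F : HeytingField c ℓ₁ ℓ₂) (ν : ℕ) where

  open CommutativeRing
    (HeytingCommutativeRing.commutativeRing (HeytingField.heytingCommutativeRing F))
  open import Algebra.Properties.Semiring.Sum semiring
  open import Relation.Binary.Reasoning.Setoid setoid

  -- Coordinates are indexed by ν * 2 rather than 2 * ν so that the library's
  -- quotient and remainder split an index into the number of its 2 × 2 block
  -- and its position inside that block.

  RowVector : Set c
  RowVector = Vector Carrier (ν ℕ.* 2)

  J : Fin 2 → Fin 2 → Carrier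
  J 0F 0F = 0#
  J 0F 1F = 1#
  J 1F 0F = - 1#
  J 1F 1F = 0#

  K : Fin (ν ℕ.* 2) → Fin (ν ℕ.* 2) → Carrier
  K i j = if does (quotient {ν} 2 i ≟ quotient {ν} 2 j)
          then J (remainder {ν} 2 i) (remainder {ν} 2 j)
          else 0#

  -- The 1 × 1 matrix α K ᵗβ.

  ⟨_,_⟩ : RowVector → RowVector → Carrier
  ⟨ α , β ⟩ = ∑[ j < ν ℕ.* 2 ] (∑[ i < ν ℕ.* 2 ] (α i * K i j) * β j)

  NonZeroVector : RowVector → Set ℓ₁
  NonZeroVector α = ¬ (∀ i → α i ≈ 0#)

  Span : RowVector → Pred RowVector (c ⊔ ℓ₁)
  Span α v = ∃[ a ] (∀ i → v i ≈ a * α i)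

  -- A one-dimensional subspace is given by a nonzero spanning vector; two
  -- such are equal when they span the same set of vectors.

  Line : Set (c ⊔ ℓ₁)
  Line = Σ[ α ∈ RowVector ] NonZeroVector α

  lines : Setoid (c ⊔ ℓ₁) (c ⊔ ℓ₁)
  lines = On.setoid (≐-setoid RowVector (c ⊔ ℓ₁)) (λ (l : Line) → Span (proj₁ l))

  Adjacent : Rel Line ℓ₁
  Adjacent (α , _) (β , _) = ¬ ⟨ α , β ⟩ ≈ 0#

  private
    J-alt : ∀ r → J r r ≈ 0#
    J-alt 0F = refl
    J-alt 1F = refl

    J-skew : ∀ r s → J r s + J s r ≈ 0#
    J-skew 0F 0F = +-identityˡ 0#
    J-skew 0F 1F = -‿inverseʳ 1#
    J-skew 1F 0F = -‿inverseˡ 1#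
    J-skew 1F 1F = +-identityˡ 0#

    K-alt : ∀ i → K i i ≈ 0#
    K-alt i with quotient {ν} 2 i ≟ quotient {ν} 2 i
    ... | yes _ = J-alt (remainder {ν} 2 i)
    ... | no  _ = refl

    K-skew : ∀ i j → K i j + K j i ≈ 0#
    K-skew i j with quotient {ν} 2 i ≟ quotient {ν} 2 j
                  | quotient {ν} 2 j ≟ quotient {ν} 2 i
    ... | yes _ | yes _ = J-skew (remainder {ν} 2 i) (remainder {ν} 2 j)
    ... | yes p | no ¬p = contradiction (≡.sym p) ¬p
    ... | no ¬p | yes p = contradiction (≡.sym p) ¬p
    ... | no  _ | no  _ = +-identityˡ 0#

    sum-zero : ∀ {n} (f : Fin n → Carrier) → (∀ i → f i ≈ 0#) → sum f ≈ 0#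
    sum-zero {n} f f≈0 = trans (sum-cong-≋ f≈0) (sum-replicate-zero n)

    term : RowVector → RowVector → Fin (ν ℕ.* 2) → Fin (ν ℕ.* 2) → Carrier
    term α β j i = α i * K i j * β j

    expand : ∀ α β → ⟨ α , β ⟩ ≈ ∑[ j < ν ℕ.* 2 ] ∑[ i < ν ℕ.* 2 ] term α β j i
    expand α β = sum-cong-≋ (λ j → *-distribʳ-sum (β j) (λ i → α i * K i j))

    term-skew : ∀ α β i j → term α β j i + term β α i j ≈ 0#
    term-skew α β i j = begin
      α i * K i j * β j + β j * K j i * α i    ≈⟨ +-cong (*-assoc _ _ _)
                                                    (trans (*-comm _ _) (*-congˡ (*-comm _ _))) ⟩
      α i * (K i j * β j) + α i * (K j i * β j) ≈⟨ distribˡ _ _ _ ⟨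
      α i * (K i j * β j + K j i * β j)         ≈⟨ *-congˡ (distribʳ _ _ _) ⟨
      α i * ((K i j + K j i) * β j)             ≈⟨ *-congˡ (*-congʳ (K-skew i j)) ⟩
      α i * (0# * β j)                          ≈⟨ *-congˡ (zeroˡ _) ⟩
      α i * 0#                                  ≈⟨ zeroʳ _ ⟩
      0#                                        ∎

    ⟨⟩-skew : ∀ α β → ⟨ α , β ⟩ + ⟨ β , α ⟩ ≈ 0#
    ⟨⟩-skew α β = begin
      ⟨ α , β ⟩ + ⟨ β , α ⟩
        ≈⟨ +-cong (expand α β) (trans (expand β α) (∑-comm (term β α))) ⟩
      ∑[ j < n ] ∑[ i < n ] term α β j i + ∑[ j < n ] ∑[ i < n ] term β α i j
        ≈⟨ ∑-distrib-+ {n} (λ j → ∑[ i < n ] term α β j i) (λ j → ∑[ i < n ] term β α i j) ⟨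
      ∑[ j < n ] (∑[ i < n ] term α β j i + ∑[ i < n ] term β α i j)
        ≈⟨ sum-zero {n} _ (λ j →
             trans (sym (∑-distrib-+ {n} (term α β j) (λ i → term β α i j)))
               (sum-zero {n} _ (λ i → term-skew α β i j))) ⟩
      0# ∎
      where n = ν ℕ.* 2

    sum-alternating : ∀ {n} (A : Fin n → Fin n → Carrier) →
      (∀ i → A i i ≈ 0#) → (∀ i j → A j i + A i j ≈ 0#) →
      ∑[ j < n ] ∑[ i < n ] A j i ≈ 0#
    sum-alternating {zero}  A alt skew = refl
    sum-alternating {suc n} A alt skew = begin
      (A 0F 0F + row) + ∑[ j < n ] (A (suc j) 0F + ∑[ i < n ] A (suc j) (suc i))
        ≈⟨ +-cong (trans (+-congʳ (alt 0F)) (+-identityˡ _))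
             (∑-distrib-+ {n} (λ j → A (suc j) 0F) (λ j → ∑[ i < n ] A (suc j) (suc i))) ⟩
      row + (col + ∑[ j < n ] ∑[ i < n ] A (suc j) (suc i))
        ≈⟨ +-congˡ (trans (+-congˡ (sum-alternating (λ j i → A (suc j) (suc i)) (alt ∘ suc)
             (λ i j → skew (suc i) (suc j)))) (+-identityʳ _)) ⟩
      row + col
        ≈⟨ ∑-distrib-+ {n} (λ i → A 0F (suc i)) (λ i → A (suc i) 0F) ⟨
      ∑[ i < n ] (A 0F (suc i) + A (suc i) 0F)
        ≈⟨ sum-zero {n} _ (λ i → skew (suc i) 0F) ⟩
      0# ∎
      where
      row = ∑[ i < n ] A 0F (suc i)
      col = ∑[ j < n ] A (suc j) 0F

    ⟨⟩-alt : ∀ α → ⟨ α , α ⟩ ≈ 0#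
    ⟨⟩-alt α = trans (expand α α) (sum-alternating (term α α)
      (λ i → trans (*-congʳ (trans (*-congˡ (K-alt i)) (zeroʳ _))) (zeroˡ _))
      (term-skew α α))

    ⟨⟩-zero-sym : ∀ α β → ⟨ α , β ⟩ ≈ 0# → ⟨ β , α ⟩ ≈ 0#
    ⟨⟩-zero-sym α β αβ≈0 =
      trans (sym (+-identityˡ _)) (trans (+-congʳ (sym αβ≈0)) (⟨⟩-skew α β))

    ⟨⟩-scaleʳ : ∀ α {β γ} a → (∀ i → γ i ≈ a * β i) → ⟨ α , γ ⟩ ≈ a * ⟨ α , β ⟩
    ⟨⟩-scaleʳ α {β} {γ} a γ≈aβ = trans (sum-cong-≋ step) (sym (*-distribˡ-sum a
      (λ j → ∑[ i < ν ℕ.* 2 ] (α i * K i j) * β j)))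
      where
      step : ∀ j → ∑[ i < ν ℕ.* 2 ] (α i * K i j) * γ j
                 ≈ a * (∑[ i < ν ℕ.* 2 ] (α i * K i j) * β j)
      step j = begin
        s * γ j         ≈⟨ *-congˡ (γ≈aβ j) ⟩
        s * (a * β j)   ≈⟨ *-assoc _ _ _ ⟨
        s * a * β j     ≈⟨ *-congʳ (*-comm _ _) ⟩
        a * s * β j     ≈⟨ *-assoc _ _ _ ⟩
        a * (s * β j)   ∎
        where s = ∑[ i < ν ℕ.* 2 ] (α i * K i j)

    self∈Span : ∀ α → Span α α
    self∈Span α = 1# , λ i → sym (*-identityˡ _)

    Adjacent-sym : Symmetric Adjacent
    Adjacent-sym {α , _} {β , _} αβ≉0 βα≈0 = αβ≉0 (⟨⟩-zero-sym β α βα≈0)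

    Adjacent-respʳ : ∀ {x y z} → Setoid._≈_ lines y z → Adjacent x y → Adjacent x z
    Adjacent-respʳ {α , _} {β , _} {γ , _} (β⊆γ , _) αβ≉0 αγ≈0 with β⊆γ (self∈Span β)
    ... | a , β≈aγ = αβ≉0 (trans (⟨⟩-scaleʳ α a β≈aγ) (trans (*-congˡ αγ≈0) (zeroʳ a)))

    Adjacent-respˡ : ∀ {x y z} → Setoid._≈_ lines y z → Adjacent y x → Adjacent z x
    Adjacent-respˡ {x} {y} {z} y≈z yx =
      Adjacent-sym {x} {z} (Adjacent-respʳ {x} {y} {z} y≈z (Adjacent-sym {y} {x} yx))

  Sp : SimpleGraph (c ⊔ ℓ₁) (c ⊔ ℓ₁) ℓ₁
  Sp = record
    { vertices   = lines
    ; Adj        = Adjacent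
    ; Adj-resp   = (λ {x} {y} {z} → Adjacent-respʳ {x} {y} {z})
                 , (λ {x} {y} {z} → Adjacent-respˡ {x} {y} {z})
    ; Adj-sym    = λ {x} {y} → Adjacent-sym {x} {y}
    ; Adj-irrefl = λ { {α , _} αα≉0 → αα≉0 (⟨⟩-alt α) }
    }

{-# OPTIONS --safe #-}
module Submission where

-- Lower bound.  A family of pairwise orthogonal vectors of F^(2ν) takes at most
-- q^ν values: by induction on ν, split the family by its first coordinate,
-- subtract a representative within each part, and drop the first hyperbolic
-- plane.  So a colour class has at most q^ν - 1 nonzero vectors, and there are
-- (q^ν - 1)(q^ν + 1) nonzero vectors in all.
--
-- Upper bound.  It is enough to have q^ν symmetric ν × ν matrices M_v such that
-- for every nonzero x the map v ↦ M_v x is a bijection: colour (x , y) by the v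
-- with M_v x = y, and by one further colour when x = 0.  If L is a field of
-- degree ν over F generated by t and ϕ a nonzero linear form on L, the Hankel
-- matrices with entries ϕ (v t^(i + j)), v ∈ L, will do.
--
-- The field L is a factor of the group algebra A = F[t] / (t^(q^ν - 1) - 1), in
-- which every element satisfies y^(q^ν) = y.  The product Ω of t^(q^d - 1) - 1
-- over 0 < d < ν is nonzero in A by its degree, so some primitive idempotent e
-- is a multiple of Ω.  In the field e A the conjugates t^(q^j), j < ν, are then
-- distinct, so 1 , t , … , t^(ν - 1) are independent over F; they span e A,
-- whose elements are roots of y^(q^ν) - y.

open import Defs
open import Algebra.Apartness using (HeytingField)
open import Algebra.Apartness.Bundles using (module HeytingCommutativeRing)
open import Algebra.Bundles using (AbelianGroup; CommutativeMonoid; CommutativeRing; Group)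
import Algebra.Construct.Pointwise as Pointwise
import Algebra.Properties.CommutativeSemigroup as CommutativeSemigroupProperties
import Algebra.Properties.CommutativeSemiring.Exp as CommExp
import Algebra.Properties.Group as GroupProperties
import Algebra.Properties.Ring as RingProperties
import Algebra.Properties.Semiring.Exp as Exp
import Algebra.Properties.Semiring.Sum as SemiringSum
open import Algebra.Structures using (IsAbelianGroup)
open import Data.Bool.Base using (if_then_else_)
open import Data.Fin.Base using
  ( Fin; zero; suc; toℕ; fromℕ<; inject₁; combine; remQuot; finToFun; funToFin
  ; punchOut; splitAt; _↑ˡ_; _↑ʳ_)
open import Data.Fin.Patterns using (0F; 1F)
import Data.Fin.Permutation as Perm
import Data.Fin.Properties as Fin
open import Data.Maybe.Base using (Maybe; just; nothing)
open import Data.Maybe.Properties using (just-injective; ≡-dec)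
open import Data.Nat.Base as ℕ using (ℕ; zero; suc; NonZero)
open import Data.Nat.Combinatorics using (_C_; k![n∸k]!∣n!; nCk≡n!/k![n-k]!; nCn≡1)
open import Data.Nat.Divisibility using (_∣_; divides; ∣⇒≤; m∣m*n)
open import Data.Nat.DivMod as DM using (_mod_)
open import Data.Nat.Primality using (Prime; euclidsLemma; prime⇒nonTrivial; prime⇒nonZero)
import Data.Nat.Properties as ℕ
open import Data.Product.Base using (∃; ∃-syntax; _,_; proj₁; proj₂) renaming (_×_ to _∧_)
open import Data.Sum.Base using (_⊎_; inj₁; inj₂; [_,_]′)
open import Data.Vec.Functional using (Vector; head; init; last; removeAt; replicate; tail)
import Data.Vec.Functional.Relation.Binary.Equality.Setoid as VecEq
open import Function.Base using (_∘_; id)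
open import Function.Bundles using (Func; Inverse; mk↔ₛ′)
open import Level using (Level; _⊔_; 0ℓ)
open import Relation.Binary.Bundles using (Setoid)
open import Relation.Binary.Definitions using (Decidable; _Respects_; tri<; tri≈; tri>)
open import Relation.Binary.PropositionalEquality as ≡ using (_≡_; _≢_)
import Relation.Binary.Reasoning.Setoid as ≈-Reasoning
open import Relation.Nullary.Decidable using (Dec; yes; no; does; map′; decidable-stable; ¬?; _×-dec_)
open import Relation.Nullary.Negation using (¬_; contradiction)
open import Relation.Unary using (Pred)
import Relation.Unary as U

private variable
  c ℓ p : Level

-- Finite sets and counting.

base≤power : ∀ m {n} .{{_ : NonZero m}} → 1 ℕ.≤ n → m ℕ.≤ m ℕ.^ n
base≤power m {n} 1≤n = ≡.subst (ℕ._≤ m ℕ.^ n) (ℕ.^-identityʳ m) (ℕ.^-monoʳ-≤ m 1≤n)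

-- A missed value `y` could be punched out, leaving an injection of `Fin (suc n)` into `Fin n`.
Fin-injective⇒surjective : ∀ {n} (f : Fin n → Fin n) → (∀ {i j} → f i ≡ f j → i ≡ j) →
                           ∀ y → ∃[ x ] f x ≡ y
Fin-injective⇒surjective {suc n} f f-inj y with Fin.any? (λ x → f x Fin.≟ y)
... | yes found = found
... | no  none  = contradiction (Fin.injective⇒≤ (λ eq → f-inj (Fin.punchOut-injective
        (λ y≡ → none (_ , ≡.sym y≡)) (λ y≡ → none (_ , ≡.sym y≡)) eq))) ℕ.1+n≰n

module Finite {S : Setoid c ℓ} {n} (card : HasCardinality S n) where
  open Setoid S
  open Inverse card using (to; from; to-cong; from-cong; strictlyInverseˡ; strictlyInverseʳ)

  to-injective : ∀ {x y} → to x ≡ to y → x ≈ y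
  to-injective {x} {y} eq = trans (sym (strictlyInverseʳ x)) (trans (from-cong eq) (strictlyInverseʳ y))

  from-injective : ∀ {i j} → from i ≈ from j → i ≡ j
  from-injective {i} {j} eq =
    ≡.trans (≡.sym (strictlyInverseˡ i)) (≡.trans (to-cong eq) (strictlyInverseˡ j))

  infix 4 _≈?_
  _≈?_ : Decidable _≈_
  x ≈? y = map′ to-injective to-cong (to x Fin.≟ to y)

  ∃? : {P : Pred Carrier p} → P Respects _≈_ → U.Decidable P → Dec (∃ P)
  ∃? resp P? = map′ (λ (i , Pi) → from i , Pi)
                    (λ (x , Px) → to x , resp (sym (strictlyInverseʳ x)) Px)
                    (Fin.any? (P? ∘ from))

  injective⇒surjective : (f : Carrier → Carrier) → (∀ {x y} → f x ≈ f y → x ≈ y) →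
                         ∀ y → ∃[ x ] f x ≈ y
  injective⇒surjective f f-inj y
    with i , eq ← Fin-injective⇒surjective (to ∘ f ∘ from)
                    (from-injective ∘ f-inj ∘ to-injective) (to y)
    = from i , to-injective eq

  -- Used to reindex sums and products over all elements of a finite field along a translation or a
  -- multiplication.
  permutation : (f g : Carrier → Carrier) → (∀ {x y} → x ≈ y → f x ≈ f y) →
                (∀ {x y} → x ≈ y → g x ≈ g y) → (∀ x → f (g x) ≈ x) → (∀ x → g (f x) ≈ x) →
                Perm.Permutation n n
  permutation f g f-cong g-cong fg gf = mk↔ₛ′ (to ∘ f ∘ from) (to ∘ g ∘ from)
    (λ i → ≡.trans (to-cong (trans (f-cong (strictlyInverseʳ _)) (fg _))) (strictlyInverseˡ i))
    (λ i → ≡.trans (to-cong (trans (g-cong (strictlyInverseʳ _)) (gf _))) (strictlyInverseˡ i))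

  funToFin-cong : ∀ {m k} {f g : Fin m → Fin k} → (∀ i → f i ≡ g i) → funToFin f ≡ funToFin g
  funToFin-cong {zero}  f≗g = ≡.refl
  funToFin-cong {suc m} f≗g = ≡.cong₂ combine (f≗g zero) (funToFin-cong (f≗g ∘ suc))

  vectors : ∀ m → HasCardinality (VecEq.≋-setoid S m) (n ℕ.^ m)
  vectors m = record
    { to        = λ v → funToFin (to ∘ v)
    ; from      = λ k → from ∘ finToFun {n} {m} k
    ; to-cong   = λ v≋w → funToFin-cong (to-cong ∘ v≋w)
    ; from-cong = λ { ≡.refl i → refl }
    ; inverse   = (λ {k} eq → ≡.trans (funToFin-cong (λ i → ≡.trans (to-cong (eq i)) (strictlyInverseˡ _)))
                                      (Fin.funToFin-finToFin {m} {n} k))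
                , (λ { {v} ≡.refl i → trans (from-cong (Fin.finToFun-funToFin (to ∘ v) i)) (strictlyInverseʳ _) })
    }

-- Binomial coefficients modulo a prime.

prime∤! : ∀ {p} → Prime p → ∀ m → m ℕ.< p → ¬ p ∣ (m ℕ.!)
prime∤! pr zero    m<p p∣ = ℕ.<⇒≱ (ℕ.nonTrivial⇒n>1 _ {{prime⇒nonTrivial pr}}) (∣⇒≤ p∣)
prime∤! pr (suc m) m<p p∣ with euclidsLemma (suc m) (m ℕ.!) pr p∣
... | inj₁ p∣1+m = ℕ.<⇒≱ m<p (∣⇒≤ p∣1+m)
... | inj₂ p∣m!  = prime∤! pr m (ℕ.<-trans (ℕ.n<1+n m) m<p) p∣m!

-- The prime divides `p !`, which is the binomial coefficient times `den`, and both factorials in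
-- `den` involve only factors below `p`.
prime∣C : ∀ {p} → Prime p → ∀ k → 0 ℕ.< k → k ℕ.< p → p ∣ p C k
prime∣C {p} pr k 0<k k<p = [ id , (λ q → contradiction q p∤den) ]′
  (euclidsLemma (p C k) den pr (≡.subst (p ∣_) p!≡ p∣p!))
  where
  den = k ℕ.! ℕ.* (p ℕ.∸ k) ℕ.!
  k≤p = ℕ.<⇒≤ k<p
  p∣p! : p ∣ p ℕ.!
  p∣p! = n∣n! p (ℕ.<-trans 0<k k<p)
    where
    n∣n! : ∀ n → 0 ℕ.< n → n ∣ n ℕ.!
    n∣n! (suc n) _ = m∣m*n (n ℕ.!)
  p!≡ : p ℕ.! ≡ (p C k) ℕ.* den
  p!≡ = ≡.trans (≡.sym (DM.m/n*n≡m {{ℕ._!*_!≢0 k (p ℕ.∸ k)}} (k![n∸k]!∣n! k≤p)))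
                (≡.cong (ℕ._* den) (≡.sym (nCk≡n!/k![n-k]! k≤p)))
  p∤den : ¬ p ∣ den
  p∤den d = [ prime∤! pr k k<p
            , prime∤! pr (p ℕ.∸ k) (ℕ.∸-monoʳ-< 0<k k≤p) ]′ (euclidsLemma (k ℕ.!) _ pr d)

-- Finite sums in a commutative ring.

module Sums (R : CommutativeRing c ℓ) where
  open CommutativeRing R hiding (zero)
  open import Algebra.Properties.Semiring.Sum semiring
  open import Algebra.Properties.Ring ring

  sum-zero : ∀ {n} (f : Vector Carrier n) → (∀ i → f i ≈ 0#) → sum f ≈ 0#
  sum-zero {n} f f≈0 = trans (sum-cong-≋ f≈0) (sum-replicate-zero n)

  sum-single : ∀ {n} (f : Vector Carrier n) k → (∀ i → i ≢ k → f i ≈ 0#) → sum f ≈ f k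
  sum-single {suc n} f k f≈0 = trans (sum-remove {n} {k} f)
    (trans (+-congˡ (sum-zero {n} (removeAt f k) (λ i → f≈0 _ (Fin.punchInᵢ≢i k i)))) (+-identityʳ _))

  sum-neg : ∀ {n} (f : Vector Carrier n) → ∑[ i < n ] (- f i) ≈ - sum f
  sum-neg {zero}  f = sym -0#≈0#
  sum-neg {suc n} f = trans (+-congˡ (sum-neg (tail f))) (-‿+-comm _ _)

  sum-minus : ∀ {n} (f g : Vector Carrier n) → ∑[ i < n ] (f i - g i) ≈ sum f - sum g
  sum-minus {n} f g = trans (∑-distrib-+ {n} f (λ i → - g i)) (+-congˡ (sum-neg g))

  x-y+y : ∀ x y → (x - y) + y ≈ x
  x-y+y x y = trans (+-assoc _ _ _) (trans (+-congˡ (-‿inverseˡ y)) (+-identityʳ x))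

  x≈y⇒x-y≈0 : ∀ {x y} → x ≈ y → x - y ≈ 0#
  x≈y⇒x-y≈0 x≈y = trans (+-congʳ x≈y) (-‿inverseʳ _)

  x-y≈0⇒x≈y : ∀ {x y} → x - y ≈ 0# → x ≈ y
  x-y≈0⇒x≈y {x} {y} eq = trans (sym (x-y+y x y)) (trans (+-congʳ eq) (+-identityˡ y))

-- Additivity of Frobenius powers.

module Frobenius (R : CommutativeRing c ℓ) where
  open CommutativeRing R hiding (zero)
  open import Algebra.Properties.Semiring.Sum semiring
  open import Algebra.Properties.Semiring.Exp semiring
  open import Algebra.Properties.Semiring.Mult semiring
  open import Algebra.Properties.CommutativeSemiring.Binomial commutativeSemiring
  open ≈-Reasoning setoid

  AdditivePower : ℕ → Set (c ⊔ ℓ)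
  AdditivePower m = ∀ x y → (x + y) ^ m ≈ x ^ m + y ^ m

  multiple-zero : ∀ {p m} → p × 1# ≈ 0# → p ∣ m → ∀ x → m × x ≈ 0#
  multiple-zero {p} p1≈0 (divides d ≡.refl) x = begin
    (d ℕ.* p) × x      ≈⟨ ×-assocˡ x d p ⟨
    d × (p × x)        ≈⟨ ×-congʳ d (×-congʳ p (*-identityˡ x)) ⟨
    d × (p × (1# * x)) ≈⟨ ×-congʳ d (×-assoc-* p 1# x) ⟨
    d × (p × 1# * x)   ≈⟨ ×-congʳ d (trans (*-congʳ p1≈0) (zeroˡ x)) ⟩
    d × 0#             ≈⟨ sum-replicate d ⟨
    sum (replicate d 0#) ≈⟨ sum-replicate-zero d ⟩
    0#                 ∎

  -- In the binomial expansion every term strictly between the first and the last has a coefficient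
  -- divisible by `p`.
  additive-prime : ∀ {p} → Prime p → p × 1# ≈ 0# → AdditivePower p
  additive-prime {zero}   pr _    x y = contradiction (ℕ.nonTrivial⇒n>1 0 {{prime⇒nonTrivial pr}}) λ()
  additive-prime p@{suc p-1} pr p1≈0 x y = begin
    (x + y) ^ p                            ≈⟨ theorem p x y ⟩
    t zero + sum (tail t)                  ≈⟨ +-cong first (sum-init-last (tail t)) ⟩
    y ^ p + (sum (init (tail t)) + last (tail t)) ≈⟨ +-congˡ (+-cong middle final) ⟩
    y ^ p + (0# + x ^ p)                   ≈⟨ trans (+-congˡ (+-identityˡ _)) (+-comm _ _) ⟩
    x ^ p + y ^ p                          ∎
    where
    t = binomialTerm x y p
    first : t zero ≈ y ^ p
    first = trans (+-identityʳ _) (*-identityˡ _)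
    middle : sum (init (tail t)) ≈ 0#
    middle = trans (sum-cong-≋ {p-1} λ i → multiple-zero p1≈0
      (prime∣C pr (suc (toℕ (inject₁ i))) (ℕ.s≤s ℕ.z≤n)
        (ℕ.s≤s (≡.subst (ℕ._< p-1) (≡.sym (Fin.toℕ-inject₁ i)) (Fin.toℕ<n i)))) _)
      (sum-replicate-zero p-1)
    final : last (tail t) ≈ x ^ p
    final rewrite Fin.toℕ-fromℕ p-1 | nCn≡1 p | ℕ.n∸n≡0 p-1 =
      trans (+-identityʳ _) (*-identityʳ _)

  additive-^ : ∀ {m} → AdditivePower m → ∀ k → AdditivePower (m ℕ.^ k)
  additive-^     add zero    x y = trans (*-identityʳ _) (sym (+-cong (*-identityʳ x) (*-identityʳ y)))
  additive-^ {m} add (suc k) x y = begin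
    (x + y) ^ (m ℕ.* m ℕ.^ k)                   ≈⟨ ^-assocʳ _ m _ ⟨
    ((x + y) ^ m) ^ (m ℕ.^ k)                   ≈⟨ ^-congˡ (m ℕ.^ k) (add x y) ⟩
    (x ^ m + y ^ m) ^ (m ℕ.^ k)                 ≈⟨ additive-^ add k _ _ ⟩
    (x ^ m) ^ (m ℕ.^ k) + (y ^ m) ^ (m ℕ.^ k)   ≈⟨ +-cong (^-assocʳ x m _) (^-assocʳ y m _) ⟩
    x ^ (m ℕ.* m ℕ.^ k) + y ^ (m ℕ.* m ℕ.^ k)   ∎

  additive-sum : ∀ {m} .{{_ : NonZero m}} → AdditivePower m → ∀ {k} (f : Vector Carrier k) →
                 sum f ^ m ≈ ∑[ i < k ] (f i ^ m)
  additive-sum {suc m} add {zero}  f = zeroˡ _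
  additive-sum {suc m} add {suc k} f = trans (add _ _) (+-congˡ (additive-sum add (tail f)))

-- Roots of polynomials over an integral domain.

NoZeroDivisors : CommutativeRing c ℓ → Set (c ⊔ ℓ)
NoZeroDivisors R = ∀ x y → x * y ≈ 0# → ¬ x ≈ 0# → y ≈ 0#
  where open CommutativeRing R

module Roots (R : CommutativeRing c ℓ) (integral : NoZeroDivisors R) where
  open CommutativeRing R hiding (zero)
  open import Algebra.Properties.Semiring.Sum semiring
  open import Algebra.Properties.Semiring.Exp semiring
  open import Algebra.Properties.Ring ring
  open Sums R using (x-y+y; x-y≈0⇒x≈y)
  open ≈-Reasoning setoid

  -- Horner's scheme, with coefficients listed from the constant term upwards.
  eval : ∀ {m} → Vector Carrier m → Carrier → Carrier
  eval {zero}  p z = 0#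
  eval {suc m} p z = head p + z * eval (tail p) z

  eval≈sum : ∀ {m} (p : Vector Carrier m) z → eval p z ≈ ∑[ i < m ] (p i * z ^ toℕ i)
  eval≈sum {zero}  p z = refl
  eval≈sum {suc m} p z = +-cong (sym (*-identityʳ _)) (begin
    z * eval (tail p) z                        ≈⟨ *-congˡ (eval≈sum (tail p) z) ⟩
    z * ∑[ i < m ] (p (suc i) * z ^ toℕ i)     ≈⟨ *-distribˡ-sum {m} z _ ⟩
    ∑[ i < m ] (z * (p (suc i) * z ^ toℕ i))   ≈⟨ sum-cong-≋ {m} (λ i →
        trans (sym (*-assoc _ _ _)) (trans (*-congʳ (*-comm _ _)) (*-assoc _ _ _))) ⟩
    ∑[ i < m ] (p (suc i) * z ^ suc (toℕ i))   ∎)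

  -- Synthetic division by z - y.
  quo : ∀ {m} → Vector Carrier (suc m) → Carrier → Vector Carrier m
  quo p y zero    = eval (tail p) y
  quo p y (suc i) = quo (tail p) y i

  -- The remainder theorem; the inductive step writes the outer factor `z` as `y + (z - y)`.
  eval-quo : ∀ {m} (p : Vector Carrier (suc m)) y z →
             eval p z ≈ eval p y + (z - y) * eval (quo p y) z
  eval-quo {zero}  p y z = begin
    head p + z * 0#                       ≈⟨ +-congˡ (trans (zeroʳ z) (sym (zeroʳ y))) ⟩
    head p + y * 0#                       ≈⟨ +-identityʳ _ ⟨
    head p + y * 0# + 0#                  ≈⟨ +-congˡ (zeroʳ _) ⟨
    head p + y * 0# + (z - y) * 0#        ∎
  eval-quo {suc m} p y z = begin
    h + z * eval t z                                  ≈⟨ +-congˡ (*-congˡ (eval-quo t y z)) ⟩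
    h + z * (e + (z - y) * Q)                         ≈⟨ +-congˡ (distribˡ _ _ _) ⟩
    h + (z * e + z * ((z - y) * Q))                   ≈⟨ +-congˡ (+-cong
        (*-congʳ (trans (sym (x-y+y z y)) (+-comm _ _)))
        (trans (sym (*-assoc _ _ _)) (trans (*-congʳ (*-comm _ _)) (*-assoc _ _ _)))) ⟩
    h + ((y + (z - y)) * e + (z - y) * (z * Q))       ≈⟨ +-congˡ (+-congʳ (distribʳ _ _ _)) ⟩
    h + ((y * e + (z - y) * e) + (z - y) * (z * Q))   ≈⟨ +-congˡ (+-assoc _ _ _) ⟩
    h + (y * e + ((z - y) * e + (z - y) * (z * Q)))   ≈⟨ +-assoc _ _ _ ⟨
    h + y * e + ((z - y) * e + (z - y) * (z * Q))     ≈⟨ +-congˡ (distribˡ _ _ _) ⟨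
    h + y * e + (z - y) * (e + z * Q)                 ∎
    where
    h = head p
    t = tail p
    e = eval t y
    Q = eval (quo t y) z

  -- The remainder of each tail is the head of the quotient one level up, so the coefficients are
  -- seen to vanish one at a time from the constant term upwards.
  quo-zero : ∀ {m} (p : Vector Carrier (suc m)) y → (∀ i → quo p y i ≈ 0#) → eval p y ≈ 0# →
             ∀ i → p i ≈ 0#
  quo-zero {zero}  p y q≈0 r≈0 zero = trans (sym (trans (+-congˡ (zeroʳ y)) (+-identityʳ _))) r≈0
  quo-zero {suc m} p y q≈0 r≈0 zero =
    trans (sym (trans (+-congˡ (trans (*-congˡ (q≈0 zero)) (zeroʳ y))) (+-identityʳ _))) r≈0
  quo-zero {suc m} p y q≈0 r≈0 (suc i) = quo-zero (tail p) y (q≈0 ∘ suc) (q≈0 zero) i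

  -- Dividing by the first root lowers the number of coefficients by one, and integrality keeps the
  -- other roots as roots of the quotient.
  zero-of-many-roots : ∀ {m} (p ρ : Vector Carrier m) → (∀ {i j} → i ≢ j → ¬ ρ i ≈ ρ j) →
                       (∀ i → eval p (ρ i) ≈ 0#) → ∀ i → p i ≈ 0#
  zero-of-many-roots {suc m} p ρ distinct root = quo-zero p (ρ zero)
    (zero-of-many-roots (quo p (ρ zero)) (tail ρ) (λ i≢j → distinct (i≢j ∘ Fin.suc-injective))
      (λ i → integral _ _
        (begin
          (ρ (suc i) - ρ zero) * eval (quo p (ρ zero)) (ρ (suc i))  ≈⟨ +-identityˡ _ ⟨
          0# + (ρ (suc i) - ρ zero) * eval (quo p (ρ zero)) (ρ (suc i)) ≈⟨ +-congʳ (root zero) ⟨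
          _  ≈⟨ eval-quo p (ρ zero) (ρ (suc i)) ⟨
          eval p (ρ (suc i)) ≈⟨ root (suc i) ⟩
          0# ∎)
        (λ eq → distinct {suc i} {zero} (λ ()) (x-y≈0⇒x≈y eq))))
    (root zero)

  X^ : ∀ m → Vector Carrier (suc m)
  X^ zero    _       = 1#
  X^ (suc m) zero    = 0#
  X^ (suc m) (suc i) = X^ m i

  eval-X^ : ∀ m z → eval (X^ m) z ≈ z ^ m
  eval-X^ zero    z = trans (+-congˡ (zeroʳ z)) (+-identityʳ 1#)
  eval-X^ (suc m) z = trans (+-identityˡ _) (*-congˡ (eval-X^ m z))

  -- X^(s+2) - X has at most s + 2 roots.
  periodic-bound : ∀ s (ρ : Vector Carrier (3 ℕ.+ s)) → (∀ {i j} → i ≢ j → ¬ ρ i ≈ ρ j) →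
                   (∀ i → ρ i ^ (2 ℕ.+ s) ≈ ρ i) → 1# ≈ 0#
  periodic-bound s ρ distinct periodic = begin
    1#           ≈⟨ -‿involutive 1# ⟨
    - - 1#       ≈⟨ -‿cong (zero-of-many-roots f ρ distinct root (suc zero)) ⟩
    - 0#         ≈⟨ -0#≈0# ⟩
    0#           ∎
    where
    f : Vector Carrier (3 ℕ.+ s)
    f zero          = 0#
    -- Vanishing of this coefficient is what turns too many roots into `1# ≈ 0#`.
    f (suc zero)    = - 1#
    f (suc (suc i)) = X^ s i
    root : ∀ i → eval f (ρ i) ≈ 0#
    root i = begin
      0# + z * (- 1# + z * eval (X^ s) z)   ≈⟨ +-identityˡ _ ⟩
      z * (- 1# + z * eval (X^ s) z)        ≈⟨ *-congˡ (+-congˡ (*-congˡ (eval-X^ s z))) ⟩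
      z * (- 1# + z ^ suc s)                ≈⟨ distribˡ _ _ _ ⟩
      z * - 1# + z ^ (2 ℕ.+ s)              ≈⟨ +-cong (trans (sym (-‿distribʳ-* z 1#)) (-‿cong (*-identityʳ z))) (periodic i) ⟩
      - z + z                               ≈⟨ -‿inverseˡ z ⟩
      0#                                    ∎
      where z = ρ i

-- Finite fields

NonzeroInvertible : CommutativeRing c ℓ → Set (c ⊔ ℓ)
NonzeroInvertible R = ∀ x → ¬ x ≈ 0# → ∃[ y ] x * y ≈ 1#
  where open CommutativeRing R

-- The order has the form `suc (suc q-2)` so that two distinct elements are at hand, which gives
-- `1≉0`.
module FiniteField
  (F : CommutativeRing c ℓ) (inverse : NonzeroInvertible F)
  {q-2 : ℕ} (card : HasCardinality (CommutativeRing.setoid F) (suc (suc q-2)))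
  where
  open CommutativeRing F hiding (zero)
  private
    q : ℕ
    q = suc (suc q-2)

  open Inverse card using (to; from; strictlyInverseʳ)
  open Finite card public
  open import Algebra.Properties.Semiring.Sum semiring
  open import Algebra.Properties.Semiring.Exp semiring
  open import Algebra.Properties.Semiring.Mult semiring
  open import Algebra.Properties.Group +-group using (identityʳ-unique)
  import Algebra.Properties.CommutativeMonoid.Sum *-commutativeMonoid as Prod
  open Sums F
  open ≈-Reasoning setoid

  1≉0 : ¬ 1# ≈ 0#
  1≉0 1≈0 = contradiction (from-injective {zero} {suc zero} (trans (≈0 _) (sym (≈0 _)))) λ ()
    where
    ≈0 : ∀ x → x ≈ 0#
    ≈0 x = trans (sym (*-identityʳ x)) (trans (*-congˡ 1≈0) (zeroʳ x))

  integral : ∀ x y → x * y ≈ 0# → ¬ x ≈ 0# → y ≈ 0#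
  integral x y xy≈0 x≉0 with x⁻¹ , xx⁻¹≈1 ← inverse x x≉0 = begin
    y               ≈⟨ *-identityˡ y ⟨
    1# * y          ≈⟨ *-congʳ xx⁻¹≈1 ⟨
    x * x⁻¹ * y     ≈⟨ *-congʳ (*-comm x x⁻¹) ⟩
    x⁻¹ * x * y     ≈⟨ *-assoc _ _ _ ⟩
    x⁻¹ * (x * y)   ≈⟨ *-congˡ xy≈0 ⟩
    x⁻¹ * 0#        ≈⟨ zeroʳ _ ⟩
    0#              ∎

  -- Adding `1#` permutes the field, so the sum of all elements equals itself plus `q × 1#`.
  q×1≈0 : q × 1# ≈ 0#
  q×1≈0 = trans (sym (sum-replicate q)) (identityʳ-unique (sum from) _ (begin
    sum from + sum (replicate q 1#)   ≈⟨ ∑-distrib-+ {q} from (replicate q 1#) ⟨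
    ∑[ i < q ] (from i + 1#)          ≈⟨ sum-cong-≋ {q} (λ i → strictlyInverseʳ (from i + 1#)) ⟨
    ∑[ i < q ] (from (π Perm.⟨$⟩ʳ i)) ≈⟨ sum-permute from π ⟨
    sum from                          ∎))
    where
    π = permutation (_+ 1#) (_- 1#) +-congʳ +-congʳ (λ x → x-y+y x 1#)
          (λ x → trans (+-assoc _ _ _) (trans (+-congˡ (-‿inverseʳ 1#)) (+-identityʳ x)))

  -- `p ^ k × 1#` is a power of `p × 1#`, and a power vanishes in a domain only if its base does.
  characteristic : ∀ {p} k → q ≡ p ℕ.^ k → p × 1# ≈ 0#
  characteristic {p} k q≡ = go k (trans (×-congˡ (≡.sym q≡)) q×1≈0)
    where
    go : ∀ k → (p ℕ.^ k) × 1# ≈ 0# → p × 1# ≈ 0#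
    go zero    eq = contradiction (trans (sym (+-identityʳ 1#)) eq) 1≉0
    go (suc k) eq with p × 1# ≈? 0#
    ... | yes p1≈0 = p1≈0
    ... | no  p1≉0 = go k (integral _ _ (trans (sym (×1-homo-* p (p ℕ.^ k))) eq) p1≉0)

  -- Replaces the factor belonging to `y ≈ 0#` by `1#`, so that a product indexed by the whole field
  -- effectively runs over its nonzero elements.
  unitOr : Carrier → Carrier → Carrier
  unitOr x y with y ≈? 0#
  ... | yes _ = 1#
  ... | no _  = x

  unitOr-zero : ∀ x {y} → y ≈ 0# → unitOr x y ≈ 1#
  unitOr-zero x {y} y≈0 with y ≈? 0#
  ... | yes _  = refl
  ... | no y≉0 = contradiction y≈0 y≉0

  unitOr-nonzero : ∀ x {y} → ¬ y ≈ 0# → unitOr x y ≈ x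
  unitOr-nonzero x {y} y≉0 with y ≈? 0#
  ... | yes y≈0 = contradiction y≈0 y≉0
  ... | no _    = refl

  -- Multiplication by x permutes the nonzero elements, so it fixes their product.
  fermat : ∀ x → x ^ q ≈ x
  fermat x with x ≈? 0#
  ... | yes x≈0 = trans (*-congʳ x≈0) (trans (zeroˡ _) (sym x≈0))
  ... | no  x≉0 = begin
    x * x ^ suc q-2             ≈⟨ *-congˡ (Prod.sum-replicate (suc q-2)) ⟨
    x * Prod.sum (replicate (suc q-2) x) ≈⟨ *-congˡ (Prod.sum-cong-≋ {suc q-2} λ i → sym (h-other i)) ⟩
    x * Prod.sum (removeAt h z) ≈⟨ *-congˡ (trans (*-congʳ h-zero) (*-identityˡ _)) ⟨
    x * (h z * Prod.sum (removeAt h z)) ≈⟨ *-congˡ (Prod.sum-remove {suc q-2} {z} h) ⟨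
    x * Prod.sum h              ≈⟨ *-congˡ ∏h≈1 ⟩
    x * 1#                      ≈⟨ *-identityʳ x ⟩
    x                           ∎
    where
    x⁻¹ = proj₁ (inverse x x≉0)
    x*x⁻¹ = proj₂ (inverse x x≉0)
    z = to 0#
    -- The product of `h` is `x` to the power `q - 1`, its entry at zero being `1#`; `g` lists the
    -- nonzero elements, again with `1#` in place of zero.
    h g : Vector Carrier q
    h i = unitOr x (from i)
    g i = unitOr (from i) (from i)

    h-zero : h z ≈ 1#
    h-zero = unitOr-zero x (strictlyInverseʳ 0#)

    h-other : ∀ i → removeAt h z i ≈ x
    h-other i = unitOr-nonzero x (λ eq → Fin.punchInᵢ≢i z i
      (from-injective (trans eq (sym (strictlyInverseʳ 0#)))))

    cancel : ∀ u v y → u * v ≈ 1# → u * (v * y) ≈ y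
    cancel u v y uv≈1 = trans (sym (*-assoc _ _ _)) (trans (*-congʳ uv≈1) (*-identityˡ y))

    π = permutation (x *_) (x⁻¹ *_) *-congˡ *-congˡ (λ y → cancel x x⁻¹ y x*x⁻¹)
          (λ y → cancel x⁻¹ x y (trans (*-comm _ _) x*x⁻¹))

    g-π : ∀ i → g (π Perm.⟨$⟩ʳ i) ≈ h i * g i
    g-π i with from i ≈? 0#
    ... | yes y≈0 = trans (unitOr-zero _ (trans (strictlyInverseʳ _) (trans (*-congˡ y≈0) (zeroʳ x))))
                          (sym (*-identityʳ 1#))
    ... | no  y≉0 = trans (unitOr-nonzero _ (λ eq → y≉0 (integral x _ (trans (sym (strictlyInverseʳ _)) eq) x≉0)))
                          (strictlyInverseʳ _)

    integral-product : ∀ {n} (f : Vector Carrier n) → (∀ i → ¬ f i ≈ 0#) → ¬ Prod.sum f ≈ 0#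
    integral-product {zero}  f f≉0 = 1≉0
    integral-product {suc n} f f≉0 eq =
      integral-product (tail f) (f≉0 ∘ suc) (integral _ _ eq (f≉0 zero))

    g≉0 : ∀ i → ¬ g i ≈ 0#
    g≉0 i with from i ≈? 0#
    ... | yes _   = 1≉0
    ... | no  y≉0 = y≉0

    ∏h≈1 : Prod.sum h ≈ 1#
    -- Reindexing along `π` leaves `Prod.sum g` unchanged but also multiplies it by `Prod.sum h`;
    -- being nonzero, it cancels.
    ∏h≈1 = x-y≈0⇒x≈y (integral (Prod.sum g) _ (begin
      Prod.sum g * (Prod.sum h - 1#)   ≈⟨ distribˡ _ _ _ ⟩
      Prod.sum g * Prod.sum h + Prod.sum g * (- 1#) ≈⟨ +-cong (*-comm _ _)
          (trans (sym (-‿distribʳ-* _ _)) (-‿cong (*-identityʳ _))) ⟩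
      Prod.sum h * Prod.sum g - Prod.sum g ≈⟨ x≈y⇒x-y≈0 (trans (sym (Prod.∑-distrib-+ {q} h g))
          (trans (Prod.sum-cong-≋ {q} (λ i → sym (g-π i))) (sym (Prod.sum-permute g π)))) ⟩
      0#                               ∎) (integral-product g g≉0))
      where open import Algebra.Properties.Ring ring using (-‿distribʳ-*)

module _ {ℓ₁ ℓ₂} (F : HeytingField c ℓ₁ ℓ₂) where
  open HeytingField F using (tight; #⇒invertible; heytingCommutativeRing)
  open CommutativeRing (HeytingCommutativeRing.commutativeRing heytingCommutativeRing)
    using (_≈_; _*_; 0#; 1#; setoid; sym; trans; +-congˡ; +-identityʳ; *-congʳ; *-congˡ; +-group)
  open import Algebra.Properties.Group +-group using (ε⁻¹≈ε)

  -- Finiteness decides whether an inverse exists. If there is none, `x` cannot be apart from `0#`,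
  -- and tightness gives `x ≈ 0#`.
  inverse : ∀ {n} → HasCardinality setoid n → ∀ x → ¬ x ≈ 0# → ∃[ y ] x * y ≈ 1#
  inverse card x x≉0 with Finite.∃? card {P = λ y → x * y ≈ 1#}
                            (λ y≈z xy≈1 → trans (*-congˡ (sym y≈z)) xy≈1)
                            (λ y → Finite._≈?_ card (x * y) 1#)
  ... | yes found = found
  ... | no  none  = contradiction (proj₁ (tight x 0#) (λ x#0 →
        let y , _ , eq = #⇒invertible x#0
        in none (y , trans (*-congʳ (trans (sym (+-identityʳ x)) (+-congˡ (sym ε⁻¹≈ε)))) eq))) x≉0

-- Group algebras

module Cyclic (r : ℕ) .{{_ : NonZero r}} where

  infixl 6 _⊕_
  _⊕_ : Fin r → Fin r → Fin r
  i ⊕ j = (toℕ i ℕ.+ toℕ j) mod r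

  ⊖_ : Fin r → Fin r
  ⊖ i = (r ℕ.∸ toℕ i) mod r

  toℕ-mod : ∀ m → toℕ (m mod r) ≡ m ℕ.% r
  toℕ-mod m = Fin.toℕ-fromℕ< (DM.m%n<n m r)

  mod-cong : ∀ {m n} → m ℕ.% r ≡ n ℕ.% r → m mod r ≡ n mod r
  mod-cong {m} {n} eq = Fin.toℕ-injective (≡.trans (toℕ-mod m) (≡.trans eq (≡.sym (toℕ-mod n))))

  mod-toℕ : ∀ i → toℕ i mod r ≡ i
  mod-toℕ i = Fin.toℕ-injective (≡.trans (toℕ-mod _) (DM.m<n⇒m%n≡m (Fin.toℕ<n i)))

  mod-⊕ : ∀ m n → (m mod r) ⊕ (n mod r) ≡ (m ℕ.+ n) mod r
  mod-⊕ m n = mod-cong (≡.trans (≡.cong₂ (λ x y → (x ℕ.+ y) ℕ.% r) (toℕ-mod m) (toℕ-mod n))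
                                (≡.sym (DM.%-distribˡ-+ m n r)))

  ⊕-comm : ∀ i j → i ⊕ j ≡ j ⊕ i
  ⊕-comm i j = ≡.cong (_mod r) (ℕ.+-comm (toℕ i) (toℕ j))

  ⊕-assoc : ∀ i j k → (i ⊕ j) ⊕ k ≡ i ⊕ (j ⊕ k)
  ⊕-assoc i j k = begin
    (i ⊕ j) ⊕ k                               ≡⟨ ≡.cong (i ⊕ j ⊕_) (mod-toℕ k) ⟨
    (i ⊕ j) ⊕ (toℕ k mod r)                   ≡⟨ mod-⊕ (toℕ i ℕ.+ toℕ j) (toℕ k) ⟩
    (toℕ i ℕ.+ toℕ j ℕ.+ toℕ k) mod r         ≡⟨ ≡.cong (_mod r) (ℕ.+-assoc (toℕ i) (toℕ j) (toℕ k)) ⟩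
    (toℕ i ℕ.+ (toℕ j ℕ.+ toℕ k)) mod r       ≡⟨ mod-⊕ (toℕ i) (toℕ j ℕ.+ toℕ k) ⟨
    (toℕ i mod r) ⊕ (j ⊕ k)                   ≡⟨ ≡.cong (_⊕ (j ⊕ k)) (mod-toℕ i) ⟩
    i ⊕ (j ⊕ k)                               ∎
    where open ≡.≡-Reasoning

  ⊕-identityˡ : ∀ i → (0 mod r) ⊕ i ≡ i
  ⊕-identityˡ i = ≡.trans (≡.cong ((0 mod r) ⊕_) (≡.sym (mod-toℕ i)))
                 (≡.trans (mod-⊕ 0 (toℕ i)) (mod-toℕ i))

  ⊕-inverseˡ : ∀ i → (⊖ i) ⊕ i ≡ 0 mod r
  ⊕-inverseˡ i = begin
    (⊖ i) ⊕ i                      ≡⟨ ≡.cong ((⊖ i) ⊕_) (mod-toℕ i) ⟨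
    (⊖ i) ⊕ (toℕ i mod r)          ≡⟨ mod-⊕ (r ℕ.∸ toℕ i) (toℕ i) ⟩
    (r ℕ.∸ toℕ i ℕ.+ toℕ i) mod r  ≡⟨ ≡.cong (_mod r) (ℕ.m∸n+n≡m (ℕ.<⇒≤ (Fin.toℕ<n i))) ⟩
    r mod r                        ≡⟨ mod-cong (DM.[m+n]%n≡m%n 0 r) ⟩
    0 mod r                        ∎
    where open ≡.≡-Reasoning

  isAbelianGroup : IsAbelianGroup _≡_ _⊕_ (0 mod r) ⊖_
  isAbelianGroup = record
    { isGroup = record
      { isMonoid = record
        { isSemigroup = record
          { isMagma = record { isEquivalence = ≡.isEquivalence ; ∙-cong = ≡.cong₂ _⊕_ }
          ; assoc = ⊕-assoc }
        ; identity = ⊕-identityˡ , λ i → ≡.trans (⊕-comm i _) (⊕-identityˡ i) }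
      ; inverse = ⊕-inverseˡ , λ i → ≡.trans (⊕-comm i _) (⊕-inverseˡ i)
      ; ⁻¹-cong = ≡.cong ⊖_ }
    ; comm = ⊕-comm }

module GroupAlgebra (F : CommutativeRing c ℓ) {n} {_∙_ : Fin n → Fin n → Fin n} {ε} {_⁻¹}
                    (isAbelianGroup : IsAbelianGroup _≡_ _∙_ ε _⁻¹) where
  G : AbelianGroup 0ℓ 0ℓ
  G = record { isAbelianGroup = isAbelianGroup }

  open AbelianGroup G using (group; assoc; comm)
  open Group (AbelianGroup.group G) using (_//_)
  open import Algebra.Properties.AbelianGroup G using (⁻¹-∙-comm)
  open import Algebra.Properties.Group group
    using (//-rightDividesˡ; //-rightDividesʳ; x≈z//y; ⁻¹-involutive)
  open CommutativeRing F hiding (zero)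
  open import Algebra.Properties.Semiring.Sum semiring
  open Sums F
  open ≈-Reasoning setoid

  infixl 7 _⋆_
  -- Convolution: `k // i` is `k ∙ (i ⁻¹)`, so a vector stands for a formal sum of group elements.
  _⋆_ : Vector Carrier n → Vector Carrier n → Vector Carrier n
  (f ⋆ g) k = ∑[ i < n ] (f i * g (k // i))

  single : Fin n → Carrier → Vector Carrier n
  single g x k with k Fin.≟ g
  ... | yes _ = x
  ... | no _  = 0#

  single-≡ : ∀ g x → single g x g ≈ x
  single-≡ g x with g Fin.≟ g
  ... | yes _  = refl
  ... | no g≢g = contradiction ≡.refl g≢g

  single-≢ : ∀ {g k} x → k ≢ g → single g x k ≈ 0#
  single-≢ {g} {k} x k≢g with k Fin.≟ g
  ... | yes k≡g = contradiction k≡g k≢g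
  ... | no _    = refl

  single-cong : ∀ g {x y} → x ≈ y → ∀ k → single g x k ≈ single g y k
  single-cong g x≈y k with k Fin.≟ g
  ... | yes _ = x≈y
  ... | no _  = refl

  single-⋆ : ∀ g x f k → (single g x ⋆ f) k ≈ x * f (k // g)
  single-⋆ g x f k = trans
    (sum-single {n} _ g (λ i i≢g → trans (*-congʳ (single-≢ x i≢g)) (zeroˡ _)))
    (*-congʳ (single-≡ g x))

  k//[k//i] : ∀ k i → k // (k // i) ≡ i
  k//[k//i] k i = ≡.sym (x≈z//y _ _ _ (≡.trans (comm i _) (//-rightDividesˡ i k)))

  k//ε : ∀ k → k // ε ≡ k
  k//ε k = ≡.sym (x≈z//y _ _ _ (AbelianGroup.identityʳ G k))

  ⋆-comm : ∀ f g k → (f ⋆ g) k ≈ (g ⋆ f) k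
  ⋆-comm f g k = begin
    ∑[ i < n ] (f i * g (k // i))                   ≈⟨ ∑-permute (λ i → f i * g (k // i)) π ⟩
    ∑[ i < n ] (f (k // i) * g (k // (k // i)))     ≈⟨ sum-cong-≋ {n} (λ i →
      trans (*-comm _ _) (*-congʳ (reflexive (≡.cong g (k//[k//i] k i))))) ⟩
    ∑[ i < n ] (g i * f (k // i))                   ∎
    where
    π : Perm.Permutation n n
    π = mk↔ₛ′ (k //_) (k //_) (k//[k//i] k) (k//[k//i] k)

  ⋆-assoc : ∀ f g h k → ((f ⋆ g) ⋆ h) k ≈ (f ⋆ (g ⋆ h)) k
  ⋆-assoc f g h k = begin
    ∑[ j < n ] (∑[ i < n ] (f i * g (j // i)) * h (k // j))
      ≈⟨ sum-cong-≋ {n} (λ j → *-distribʳ-sum {n} (h (k // j)) _) ⟩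
    ∑[ j < n ] ∑[ i < n ] (f i * g (j // i) * h (k // j))
      ≈⟨ ∑-comm {n} {n} _ ⟩
    ∑[ i < n ] ∑[ j < n ] (f i * g (j // i) * h (k // j))
      ≈⟨ sum-cong-≋ {n} (λ i → trans (sum-cong-≋ {n} (λ j → *-assoc _ _ _))
                                     (sym (*-distribˡ-sum {n} (f i) _))) ⟩
    ∑[ i < n ] (f i * ∑[ j < n ] (g (j // i) * h (k // j)))
      ≈⟨ sum-cong-≋ {n} (λ i → *-congˡ (trans (∑-permute _ (π i)) (sum-cong-≋ {n} (λ j →
           *-cong (reflexive (≡.cong g (//-rightDividesʳ i j))) (reflexive (≡.cong h (shift i j))))))) ⟩
    ∑[ i < n ] (f i * ∑[ j < n ] (g j * h ((k // i) // j)))  ∎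
    where
    π : ∀ i → Perm.Permutation n n
    π i = mk↔ₛ′ (_∙ i) (_// i) (//-rightDividesˡ i) (//-rightDividesʳ i)
    shift : ∀ i j → k // (j ∙ i) ≡ (k // i) // j
    shift i j = ≡.trans (≡.cong (k ∙_) (≡.trans (≡.cong _⁻¹ (comm j i)) (≡.sym (⁻¹-∙-comm i j)))) (≡.sym (assoc k _ _))

  ⋆-identityˡ : ∀ f k → (single ε 1# ⋆ f) k ≈ f k
  ⋆-identityˡ f k = trans (single-⋆ ε 1# f k) (trans (*-identityˡ _) (reflexive (≡.cong f (k//ε k))))

  ⋆-distribˡ : ∀ f g h k → (f ⋆ (λ i → g i + h i)) k ≈ (f ⋆ g) k + (f ⋆ h) k
  ⋆-distribˡ f g h k = trans (sum-cong-≋ {n} (λ i → distribˡ _ _ _)) (∑-distrib-+ {n} _ _)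

  algebra : CommutativeRing c ℓ
  algebra = record
    { Carrier = Vector Carrier n
    ; _≈_ = λ f g → ∀ i → f i ≈ g i
    ; _+_ = λ f g i → f i + g i
    ; _*_ = _⋆_
    ; -_ = λ f i → - f i
    ; 0# = λ _ → 0#
    ; 1# = single ε 1#
    ; isCommutativeRing = record
      { isRing = record
        { +-isAbelianGroup = Pointwise.isAbelianGroup (Fin n) +-isAbelianGroup
        ; *-cong = λ f≈ g≈ k → sum-cong-≋ {n} (λ i → *-cong (f≈ i) (g≈ (k // i)))
        ; *-assoc = ⋆-assoc
        ; *-identity = ⋆-identityˡ , λ f k → trans (⋆-comm f _ k) (⋆-identityˡ f k)
        ; distrib = ⋆-distribˡ , λ f g h k → trans (⋆-comm _ f k)
            (trans (⋆-distribˡ f g h k) (+-cong (⋆-comm f g k) (⋆-comm f h k)))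
        }
      ; *-comm = ⋆-comm
      }
    }

  module A = CommutativeRing algebra
  module ASum = SemiringSum A.semiring
  open ASum public using () renaming (sum to sumᴬ)

  sum-at : ∀ {m} (f : Vector A.Carrier m) k → sumᴬ f k ≈ ∑[ i < m ] f i k
  sum-at {zero}  f k = refl
  sum-at {suc m} f k = +-congˡ (sum-at (tail f) k)

  constant : Carrier → A.Carrier
  constant = single ε

  basis : Fin n → A.Carrier
  basis g = single g 1#

  constant-⋆ : ∀ x f k → (constant x ⋆ f) k ≈ x * f k
  constant-⋆ x f k = trans (single-⋆ ε x f k) (*-congˡ (reflexive (≡.cong f (k//ε k))))

  constant-* : ∀ x y → constant (x * y) A.≈ constant x A.* constant y
  constant-* x y k = sym (trans (constant-⋆ x (constant y) k) (help k))
    where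
    help : ∀ k → x * constant y k ≈ constant (x * y) k
    help k with k Fin.≟ ε
    ... | yes _ = refl
    ... | no _  = zeroʳ x

  constant-minus : ∀ x y → constant (x - y) A.≈ (constant x A.- constant y)
  constant-minus x y k with k Fin.≟ ε
  ... | yes _ = refl
  ... | no _  = sym (-‿inverseʳ 0#)

  constant-0 : constant 0# A.≈ A.0#
  constant-0 k with k Fin.≟ ε
  ... | yes _ = refl
  ... | no _  = refl

  basis-∙ : ∀ g h → basis g A.* basis h A.≈ basis (g ∙ h)
  basis-∙ g h k = trans (single-⋆ g 1# (basis h) k) (trans (*-identityˡ _) help)
    where
    help : single h 1# (k // g) ≈ single (g ∙ h) 1# k
    help with k // g Fin.≟ h | k Fin.≟ g ∙ h
    ... | yes _ | yes _ = refl
    ... | no  _ | no  _ = refl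
    ... | yes p | no ¬q = contradiction (≡.trans (≡.sym (//-rightDividesˡ g k)) (≡.trans (comm _ g) (≡.cong (g ∙_) p))) ¬q
    ... | no ¬p | yes q = contradiction (≡.sym (x≈z//y _ _ _ (≡.trans (comm h g) (≡.sym q)))) ¬p

  expansion : ∀ f → f A.≈ sumᴬ (λ i → constant (f i) A.* basis i)
  expansion f k = sym (begin
    sumᴬ (λ i → constant (f i) A.* basis i) k       ≈⟨ sum-at {n} _ k ⟩
    ∑[ i < n ] ((constant (f i) ⋆ basis i) k)       ≈⟨ sum-cong-≋ {n} (λ i → constant-⋆ (f i) (basis i) k) ⟩
    ∑[ i < n ] (f i * basis i k)                    ≈⟨ sum-single {n} _ k (λ i i≢k →
                                                        trans (*-congˡ (single-≢ 1# (i≢k ∘ ≡.sym))) (zeroʳ _)) ⟩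
    f k * basis k k                                 ≈⟨ trans (*-congˡ (single-≡ k 1#)) (*-identityʳ _) ⟩
    f k                                             ∎)

  -- Multiplication by a group element moves any coefficient to the identity, so the single linear
  -- form "coefficient at `ε`" sees all of them.
  coefficient-at : ∀ f k → f k ≈ (f A.* basis (k ⁻¹)) ε
  coefficient-at f k = sym (trans (⋆-comm f _ ε) (trans (single-⋆ (k ⁻¹) 1# f ε)
    (trans (*-identityˡ _) (reflexive (≡.cong f
      (≡.trans (AbelianGroup.identityˡ G _) (⁻¹-involutive k)))))))

-- Idempotents and spread sets

Periodic : CommutativeRing c ℓ → ℕ → Set (c ⊔ ℓ)
Periodic R m = ∀ x → x ^ m ≈ x
  where
  open CommutativeRing R
  open Exp semiring

module PrimitiveIdempotent (R : CommutativeRing c ℓ) (_≈?_ : Decidable (CommutativeRing._≈_ R))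
  (s : ℕ) (periodic : Periodic R (suc (suc s))) where
  open CommutativeRing R hiding (zero)
  open Exp semiring
  open ≈-Reasoning setoid

  -- Periodicity gives `x * x ^ suc s ≈ x`, so this power is the idempotent that generates the same
  -- ideal as `x`.
  ^-idempotent : ∀ x → x ^ suc s * x ^ suc s ≈ x ^ suc s
  ^-idempotent x = begin
    x ^ suc s * x ^ suc s     ≈⟨ ^-homo-* x (suc s) (suc s) ⟨
    x ^ (suc s ℕ.+ suc s)     ≈⟨ ^-congʳ x (ℕ.+-suc (suc s) s) ⟩
    x ^ (suc (suc s) ℕ.+ s)   ≈⟨ ^-homo-* x (suc (suc s)) s ⟩
    x ^ suc (suc s) * x ^ s   ≈⟨ *-congʳ (periodic x) ⟩
    x * x ^ s                 ∎

  *-idempotent : ∀ {x y} → x * x ≈ x → y * y ≈ y → (x * y) * (x * y) ≈ x * y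
  *-idempotent {x} {y} xx yy = begin
    (x * y) * (x * y)   ≈⟨ *-assoc _ _ _ ⟩
    x * (y * (x * y))   ≈⟨ *-congˡ (trans (sym (*-assoc _ _ _)) (*-congʳ (*-comm y x))) ⟩
    x * (x * y * y)     ≈⟨ *-congˡ (*-assoc _ _ _) ⟩
    x * (x * (y * y))   ≈⟨ *-assoc _ _ _ ⟨
    x * x * (y * y)     ≈⟨ *-cong xx yy ⟩
    x * y               ∎

  -- Multiplies e in turn by each idempotent u = v i ^ suc s that does not kill it;
  -- at the end every u either kills or fixes the result.
  shrink : ∀ {m} (v : Vector Carrier m) e → e * e ≈ e → ¬ e ≈ 0# →
           ∃[ w ] (¬ e * w ≈ 0#) ∧ ((e * w) * (e * w) ≈ e * w) ∧
             (∀ i → (e * w) * v i ^ suc s ≈ 0# ⊎ (e * w) * v i ^ suc s ≈ e * w)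
  shrink {zero} v e ee≈e e≉0 =
    1# , (λ eq → e≉0 (trans (sym e1≈e) eq)) , trans (*-cong e1≈e e1≈e) (trans ee≈e (sym e1≈e)) , λ ()
    where e1≈e = *-identityʳ e
  shrink {suc m} v e ee≈e e≉0 with (e * v zero ^ suc s) ≈? 0#
  -- The final idempotent is a multiple of `e`, so whatever `e` kills is killed at the end.
  ... | yes eu≈0 with w , ew≉0 , idem , split ← shrink (tail v) e ee≈e e≉0 =
    w , ew≉0 , idem , λ where
      zero    → inj₁ (begin
        e * w * u     ≈⟨ *-assoc _ _ _ ⟩
        e * (w * u)   ≈⟨ *-congˡ (*-comm w u) ⟩
        e * (u * w)   ≈⟨ *-assoc _ _ _ ⟨
        e * u * w     ≈⟨ *-congʳ eu≈0 ⟩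
        0# * w        ≈⟨ zeroˡ w ⟩
        0#            ∎)
      (suc i) → split i
    where u = v zero ^ suc s
  -- Once `u` is a factor of the idempotent, `u * u ≈ u` makes it fix the final result.
  ... | no  eu≉0 with w , ew≉0 , idem , split ← shrink (tail v) (e * v zero ^ suc s)
      (*-idempotent ee≈e (^-idempotent (v zero))) eu≉0 =
    u * w , (λ eq → ew≉0 (trans assoc′ eq))
    , trans (*-cong (sym assoc′) (sym assoc′)) (trans idem assoc′)
    , λ where
      zero    → inj₂ (begin
        e * (u * w) * u     ≈⟨ *-congʳ (*-congˡ (*-comm u w)) ⟩
        e * (w * u) * u     ≈⟨ *-assoc _ _ _ ⟩
        e * ((w * u) * u)   ≈⟨ *-congˡ (*-assoc _ _ _) ⟩
        e * (w * (u * u))   ≈⟨ *-congˡ (*-congˡ (^-idempotent (v zero))) ⟩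
        e * (w * u)         ≈⟨ *-congˡ (*-comm w u) ⟩
        e * (u * w)         ∎)
      (suc i) → [ (λ eq → inj₁ (trans (*-congʳ (sym assoc′)) eq))
                , (λ eq → inj₂ (trans (*-congʳ (sym assoc′)) (trans eq assoc′))) ]′ (split i)
    where
    u = v zero ^ suc s
    assoc′ : e * u * w ≈ e * (u * w)
    assoc′ = *-assoc _ _ _

-- R with x and y identified when e x = e y, a copy of the ideal e R.
module Corner (R : CommutativeRing c ℓ) (e : CommutativeRing.Carrier R) where
  open CommutativeRing R hiding (zero)

  infix 4 _∼_
  _∼_ : Carrier → Carrier → Set ℓ
  x ∼ y = e * x ≈ e * y

  ≈⇒∼ : ∀ {x y} → x ≈ y → x ∼ y
  ≈⇒∼ = *-congˡ

  private
    *-∼ˡ : ∀ x {y z} → y ∼ z → x * y ∼ x * z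
    *-∼ˡ x {y} {z} y∼z = trans (swap y) (trans (*-congˡ y∼z) (sym (swap z)))
      where
      swap : ∀ y → e * (x * y) ≈ x * (e * y)
      swap y = trans (sym (*-assoc _ _ _)) (trans (*-congʳ (*-comm e x)) (*-assoc _ _ _))

    *-∼ʳ : ∀ x {y z} → y ∼ z → y * x ∼ z * x
    *-∼ʳ x y∼z = trans (≈⇒∼ (*-comm _ x)) (trans (*-∼ˡ x y∼z) (≈⇒∼ (*-comm x _)))

    -‿∼ : ∀ {x y} → x ∼ y → - x ∼ - y
    -‿∼ x∼y = trans (sym (-‿distribʳ-* e _)) (trans (-‿cong x∼y) (-‿distribʳ-* e _))
      where open import Algebra.Properties.Ring ring

  corner : CommutativeRing c ℓ
  corner = record
    { Carrier = Carrier ; _≈_ = _∼_ ; _+_ = _+_ ; _*_ = _*_ ; -_ = -_ ; 0# = 0# ; 1# = 1#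
    ; isCommutativeRing = record
      { isRing = record
        { +-isAbelianGroup = record
          { isGroup = record
            { isMonoid = record
              { isSemigroup = record
                { isMagma = record
                  { isEquivalence = record { refl = refl ; sym = sym ; trans = trans }
                  ; ∙-cong = λ x∼y u∼v → trans (distribˡ _ _ _)
                      (trans (+-cong x∼y u∼v) (sym (distribˡ _ _ _))) }
                ; assoc = λ x y z → ≈⇒∼ (+-assoc x y z) }
              ; identity = (λ x → ≈⇒∼ (+-identityˡ x)) , λ x → ≈⇒∼ (+-identityʳ x) }
            ; inverse = (λ x → ≈⇒∼ (-‿inverseˡ x)) , λ x → ≈⇒∼ (-‿inverseʳ x)
            ; ⁻¹-cong = -‿∼ }
          ; comm = λ x y → ≈⇒∼ (+-comm x y) }
        ; *-cong = λ {x} {y} {u} {v} x∼y u∼v → trans (*-∼ˡ x u∼v) (*-∼ʳ v x∼y)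
        ; *-assoc = λ x y z → ≈⇒∼ (*-assoc x y z)
        ; *-identity = (λ x → ≈⇒∼ (*-identityˡ x)) , λ x → ≈⇒∼ (*-identityʳ x)
        ; distrib = (λ x y z → ≈⇒∼ (distribˡ x y z)) , λ x y z → ≈⇒∼ (distribʳ x y z)
        }
      ; *-comm = λ x y → ≈⇒∼ (*-comm x y)
      }
    }

-- The subspaces {(x , matrix v x)} together with {(0 , x)} are a symplectic spread.
record SpreadSet (F : CommutativeRing c ℓ) (n : ℕ) : Set (c ⊔ ℓ) where
  open CommutativeRing F
  open SemiringSum semiring
  field
    matrix      : Vector Carrier n → Fin n → Fin n → Carrier
    matrix-cong : ∀ {u v : Vector Carrier n} → (∀ i → u i ≈ v i) → ∀ i j → matrix u i j ≈ matrix v i j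
    symmetric   : ∀ v i j → matrix v i j ≈ matrix v j i
    injective   : ∀ (y : Vector Carrier n) → ¬ (∀ i → y i ≈ 0#) → ∀ (u v : Vector Carrier n) →
                  (∀ i → ∑[ j < n ] (matrix u i j * y j) ≈ ∑[ j < n ] (matrix v i j * y j)) →
                  ∀ i → u i ≈ v i

-- The group algebra of the cyclic group of order `q ^ n - 1`.

module CyclicAlgebra
  (F : CommutativeRing c ℓ) (inverse : NonzeroInvertible F)
  {q-2 : ℕ} (card : HasCardinality (CommutativeRing.setoid F) (suc (suc q-2)))
  {p k} (p-prime : Prime p) (q≡p^k : suc (suc q-2) ≡ p ℕ.^ k)
  (n-1 : ℕ) {s : ℕ} (q^n≡1+r : suc (suc q-2) ℕ.^ suc n-1 ≡ suc (suc s))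
  where
  open CommutativeRing F hiding (zero)
  private
    q n r : ℕ
    q = suc (suc q-2)
    n = suc n-1
    r = suc s

  open Cyclic r
  open GroupAlgebra F isAbelianGroup public
  module FF = FiniteField F inverse card
  open Exp A.semiring public using () renaming (_^_ to _^ᴬ_; ^-congˡ to ^ᴬ-congˡ; ^-congʳ to ^ᴬ-congʳ; ^-assocʳ to ^ᴬ-assocʳ)
  open Exp semiring using (_^_)
  open Frobenius algebra

  -- The class of the monomial `t^m` modulo `t^r - 1`.
  x^ : ℕ → A.Carrier
  x^ m = basis (m mod r)

  x^-+ : ∀ m m′ → x^ m A.* x^ m′ A.≈ x^ (m ℕ.+ m′)
  x^-+ m m′ = A.trans (basis-∙ (m mod r) (m′ mod r))
                      (A.reflexive (≡.cong basis (mod-⊕ m m′)))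

  x^-cong : ∀ {m m′} → m ℕ.% r ≡ m′ ℕ.% r → x^ m A.≈ x^ m′
  x^-cong {m} {m′} eq = A.reflexive (≡.cong basis (mod-cong {m} {m′} eq))

  x^-+r : ∀ m → x^ (m ℕ.+ r) A.≈ x^ m
  x^-+r m = x^-cong {m ℕ.+ r} {m} (DM.[m+n]%n≡m%n m r)

  x^-q^n : ∀ m → x^ (m ℕ.* q ℕ.^ n) A.≈ x^ m
  x^-q^n m = x^-cong {m ℕ.* q ℕ.^ n} {m} (≡.trans
    (≡.cong (ℕ._% r) (≡.trans (≡.cong (m ℕ.*_) q^n≡1+r) (ℕ.*-suc m r))) (DM.[m+kn]%n≡m%n m m r))

  x^-^ : ∀ m j → x^ m ^ᴬ j A.≈ x^ (m ℕ.* j)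
  x^-^ m zero    = x^-cong {0} {m ℕ.* 0} (≡.cong (ℕ._% r) (≡.sym (ℕ.*-zeroʳ m)))
  x^-^ m (suc j) = A.trans (A.*-congˡ {x^ m} (x^-^ m j)) (A.trans (x^-+ m (m ℕ.* j))
    (A.reflexive (≡.cong x^ (≡.sym (ℕ.*-suc m j)))))

  basis-x^ : ∀ i → basis i A.≈ x^ (toℕ i)
  basis-x^ i = A.reflexive (≡.cong basis (≡.sym (mod-toℕ i)))

  constant-^ : ∀ y j → constant y ^ᴬ j A.≈ constant (y ^ j)
  constant-^ y zero    = A.refl
  constant-^ y (suc j) = A.trans (A.*-congˡ {constant y} (constant-^ y j)) (A.sym (constant-* y (y ^ j)))

  -- Fermat's identity in `F`, iterated; together with `frobenius-+` it makes the `q`-power map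
  -- linear over `F`.
  constant-frobenius : ∀ y j → constant y ^ᴬ (q ℕ.^ j) A.≈ constant y
  constant-frobenius y zero    = A.*-identityʳ (constant y)
  constant-frobenius y (suc j) = A.trans (A.sym (^ᴬ-assocʳ (constant y) q (q ℕ.^ j)))
    (A.trans (^ᴬ-congˡ (q ℕ.^ j) (A.trans (constant-^ y q) (single-cong _ (FF.fermat y))))
             (constant-frobenius y j))

  -- The algebra inherits the characteristic `p` of `F`, and `q` is a power of `p`.
  frobenius-+ : ∀ j → AdditivePower (q ℕ.^ j)
  frobenius-+ = additive-^ (≡.subst AdditivePower (≡.sym q≡p^k) (additive-^ (additive-prime p-prime p×1≈0) k))
    where
    open import Algebra.Properties.Semiring.Mult semiring using (_×_)
    open import Algebra.Properties.Semiring.Mult A.semiring using () renaming (_×_ to _×ᴬ_)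
    multiple : ∀ m → m ×ᴬ A.1# A.≈ constant (m × 1#)
    multiple zero    = A.sym constant-0
    multiple (suc m) i with multiple m i
    ... | eq with i Fin.≟ 0 mod r
    ... | yes _ = +-congˡ eq
    ... | no  _ = trans (+-identityˡ _) eq
    p×1≈0 : p ×ᴬ A.1# A.≈ A.0#
    p×1≈0 = A.trans (multiple p) (A.trans (single-cong _ (FF.characteristic k q≡p^k)) constant-0)

  combination : ∀ {m} → Vector Carrier m → Vector ℕ m → A.Carrier
  combination y d = sumᴬ (λ i → constant (y i) A.* x^ (d i))

  -- Frobenius is additive and multiplicative and fixes scalars, so it acts on the exponents alone.
  frobenius-combination : ∀ {m} (y : Vector Carrier m) d j →
    combination y d ^ᴬ (q ℕ.^ j) A.≈ combination y (λ i → d i ℕ.* q ℕ.^ j)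
  frobenius-combination {m} y d j = A.trans
    (additive-sum {{ℕ.m^n≢0 q j}} (frobenius-+ j) (λ i → constant (y i) A.* x^ (d i)))
    (ASum.sum-cong-≋ {m} (λ i → A.trans
      (CommExp.^-distrib-* A.commutativeSemiring (constant (y i)) (x^ (d i)) (q ℕ.^ j))
      (A.*-cong (constant-frobenius (y i) j) (x^-^ (d i) (q ℕ.^ j)))))

  combination-congʳ : ∀ {m} (y : Vector Carrier m) {d d′} → (∀ i → x^ (d i) A.≈ x^ (d′ i)) →
                      combination y d A.≈ combination y d′
  combination-congʳ {m} y eq = ASum.sum-cong-≋ {m} (λ i → A.*-congˡ {constant (y i)} (eq i))

  -- Raising to the power `q ^ n` multiplies the exponents by `q ^ n`, which is 1 modulo `r`.
  periodic : ∀ y → y ^ᴬ suc r A.≈ y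
  periodic y = begin
    y ^ᴬ suc r                                       ≈⟨ ^ᴬ-congʳ y (≡.sym q^n≡1+r) ⟩
    y ^ᴬ (q ℕ.^ n)                                   ≈⟨ ^ᴬ-congˡ (q ℕ.^ n) expand ⟩
    combination y toℕ ^ᴬ (q ℕ.^ n)                   ≈⟨ frobenius-combination y toℕ n ⟩
    combination y (λ i → toℕ i ℕ.* q ℕ.^ n)          ≈⟨ combination-congʳ y {λ i → toℕ i ℕ.* q ℕ.^ n} {toℕ} (λ i → x^-q^n (toℕ i)) ⟩
    combination y toℕ                                ≈⟨ expand ⟨
    y                                                ∎
    where
    open ≈-Reasoning A.setoid
    expand : y A.≈ combination y toℕ
    expand = A.trans (expansion y) (ASum.sum-cong-≋ {r} (λ i → A.*-congˡ {constant (y i)} (basis-x^ i)))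

  -- ∏ (x^(q^d - 1) - 1) over 1 ≤ d ≤ m.  Its degree for m = n - 1 is below r,
  -- so it does not vanish modulo x^r - 1.
  noSmallerPeriod : ℕ → A.Carrier
  noSmallerPeriod zero    = A.1#
  noSmallerPeriod (suc m) = (x^ (ℕ.pred (q ℕ.^ suc m)) A.- A.1#) A.* noSmallerPeriod m

  degree : ℕ → ℕ
  degree zero    = 0
  degree (suc m) = ℕ.pred (q ℕ.^ suc m) ℕ.+ degree m

  -- Speaks of the representative of degree below `r`. For `d` at least `r` both conditions are
  -- vacuous, so `monic-step` can be stated for all degrees.
  Monic : ℕ → A.Carrier → Set ℓ
  Monic d f = (∀ i → toℕ i ≡ d → f i ≈ 1#) ∧ (∀ i → d ℕ.< toℕ i → f i ≈ 0#)

  -- A geometric sum: the new term is below `Q`, the earlier ones together are below `Q`, and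
  -- `Q + Q` is at most `q * Q`.
  degree-bound : ∀ m → suc (degree m) ℕ.< q ℕ.^ suc m
  degree-bound zero    = ℕ.s≤s (ℕ.s≤s ℕ.z≤n)
  degree-bound (suc m) = begin-strict
    suc (ℕ.pred Q ℕ.+ degree m)   ≡⟨ ≡.cong (ℕ._+ degree m) (ℕ.suc-pred Q {{ℕ.m^n≢0 q (suc m)}}) ⟩
    Q ℕ.+ degree m                <⟨ ℕ.+-monoʳ-< Q (ℕ.<-trans (ℕ.n<1+n _) (degree-bound m)) ⟩
    Q ℕ.+ Q                       ≤⟨ ℕ.+-monoʳ-≤ Q (ℕ.m≤m+n Q (q-2 ℕ.* Q)) ⟩
    q ℕ.* Q                       ∎
    where
    Q = q ℕ.^ suc m
    open ℕ.≤-Reasoning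

  -- At an index `i` of at least `t` nothing wraps around, so the product has coefficient
  -- `f (i - t) - f i` there; from index `t + d` on, the second term is already zero.
  monic-step : ∀ {d f} t → 0 ℕ.< t → Monic d f → Monic (t ℕ.+ d) ((x^ t A.- A.1#) A.* f)
  monic-step {d} {f} t 0<t (lead , above) = lead′ , above′
    where
    open ≈-Reasoning setoid
    open RingProperties ring using (-0#≈0#)
    at : ∀ i i′ → toℕ i ≡ t ℕ.+ toℕ i′ → ((x^ t A.- A.1#) A.* f) i ≈ f i′ - f i
    at i i′ i≡ = trans (A.distribʳ f (x^ t) (A.- A.1#) i)
      (+-cong (trans (single-⋆ (t mod r) 1# f i) (trans (*-identityˡ _) (reflexive (≡.cong f
                (≡.sym (GroupProperties.x≈z//y (AbelianGroup.group G) i′ (t mod r) i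
                  (≡.trans (≡.cong (_⊕ (t mod r)) (≡.sym (mod-toℕ i′)))
                  (≡.trans (mod-⊕ (toℕ i′) t)
                  (≡.trans (≡.cong (_mod r) (≡.trans (ℕ.+-comm (toℕ i′) t) (≡.sym i≡))) (mod-toℕ i))))))))))
              (trans (sym (RingProperties.-‿distribˡ-* A.ring A.1# f i)) (-‿cong (A.*-identityˡ f i))))
    below : ∀ i → t ℕ.≤ toℕ i → ∃[ i′ ] toℕ i ≡ t ℕ.+ toℕ i′
    below i t≤i = (toℕ i ℕ.∸ t) mod r ,
      ≡.trans (≡.sym (ℕ.m+[n∸m]≡n t≤i)) (≡.cong (t ℕ.+_) (≡.sym (≡.trans (toℕ-mod (toℕ i ℕ.∸ t))
        (DM.m<n⇒m%n≡m (ℕ.≤-<-trans (ℕ.m∸n≤m (toℕ i) t) (Fin.toℕ<n i))))))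
    lead′ : ∀ i → toℕ i ≡ t ℕ.+ d → _
    lead′ i i≡ with i′ , eq ← below i (≡.subst (t ℕ.≤_) (≡.sym i≡) (ℕ.m≤m+n t d)) = begin
      ((x^ t A.- A.1#) A.* f) i   ≈⟨ at i i′ eq ⟩
      f i′ - f i                  ≈⟨ +-cong (lead i′ (ℕ.+-cancelˡ-≡ t _ _ (≡.trans (≡.sym eq) i≡)))
                                            (-‿cong (above i (≡.subst (d ℕ.<_) (≡.sym i≡) (ℕ.m<n+m d 0<t)))) ⟩
      1# - 0#                     ≈⟨ trans (+-congˡ -0#≈0#) (+-identityʳ 1#) ⟩
      1#                          ∎
    above′ : ∀ i → t ℕ.+ d ℕ.< toℕ i → _
    above′ i t+d<i with i′ , eq ← below i (ℕ.≤-trans (ℕ.m≤m+n t d) (ℕ.<⇒≤ t+d<i)) = begin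
      ((x^ t A.- A.1#) A.* f) i   ≈⟨ at i i′ eq ⟩
      f i′ - f i                  ≈⟨ +-cong (above i′ (ℕ.+-cancelˡ-< t _ _ (≡.subst (t ℕ.+ d ℕ.<_) eq t+d<i)))
                                            (-‿cong (above i (ℕ.≤-<-trans (ℕ.m≤n+m d t) t+d<i))) ⟩
      0# - 0#                     ≈⟨ -‿inverseʳ 0# ⟩
      0#                          ∎

  noSmallerPeriod-monic : ∀ m → Monic (degree m) (noSmallerPeriod m)
  noSmallerPeriod-monic zero =
      (λ i i≡0 → trans (reflexive (≡.cong (single (0 mod r) 1#) (Fin.toℕ-injective i≡0))) (single-≡ (0 mod r) 1#))
    , (λ i 0<i → single-≢ 1# λ i≡0 → ℕ.<⇒≢ 0<i (≡.sym (≡.cong toℕ i≡0)))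
  noSmallerPeriod-monic (suc m) = monic-step (ℕ.pred Q) (ℕ.≤-pred (≡.subst (2 ℕ.≤_) (≡.sym (ℕ.suc-pred Q {{ℕ.m^n≢0 q (suc m)}})) 2≤Q)) (noSmallerPeriod-monic m)
    where
    Q = q ℕ.^ suc m
    2≤Q : 2 ℕ.≤ Q
    2≤Q = ℕ.≤-trans (ℕ.s≤s (ℕ.s≤s ℕ.z≤n)) (degree-bound m)

  noSmallerPeriod≉0 : ¬ noSmallerPeriod n-1 A.≈ A.0#
  noSmallerPeriod≉0 eq = FF.1≉0 (trans (sym (proj₁ (noSmallerPeriod-monic n-1) i (Fin.toℕ-fromℕ< d<r))) (eq i))
    where
    d<r : degree n-1 ℕ.< r
    d<r = ℕ.≤-pred (≡.subst (suc (degree n-1) ℕ.<_) q^n≡1+r (degree-bound n-1))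
    i = fromℕ< d<r

  open Finite (FF.vectors r) using () renaming (_≈?_ to _≈ᴬ?_)
  open PrimitiveIdempotent algebra _≈ᴬ?_ s periodic

  private
    Ω = noSmallerPeriod n-1

    ^-zero : ∀ {y} → y ^ᴬ r A.≈ A.0# → y A.≈ A.0#
    ^-zero {y} eq = A.trans (A.sym (periodic y)) (A.trans (A.*-congˡ {y} eq) (A.zeroʳ y))

  -- Since `y ^ᴬ r` is the idempotent belonging to `y`, the third condition says that `y` is zero or
  -- invertible in the corner of `e`. The last one makes `Ω` invertible there.
  IsPrimitive : A.Carrier → Set (c ⊔ ℓ)
  IsPrimitive e = (¬ e A.≈ A.0#) ∧ (e A.* e A.≈ e) ∧
    (∀ y → (e A.* y ^ᴬ r A.≈ A.0#) ⊎ (e A.* y ^ᴬ r A.≈ e)) ∧ (∃[ z ] e A.≈ Ω A.* z)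

  private
    elements : Vector A.Carrier _
    elements = Inverse.from (FF.vectors r)

    -- `shrink` tests only the listed `elements`; the enumeration of the algebra carries the
    -- dichotomy to every `y`. Divisibility by `Ω` comes from unfolding `Ω ^ᴬ r` once.
    fromShrunk : ∃[ w ] (¬ (Ω ^ᴬ r) A.* w A.≈ A.0#) ∧
        ((Ω ^ᴬ r A.* w) A.* (Ω ^ᴬ r A.* w) A.≈ Ω ^ᴬ r A.* w) ∧
        (∀ i → ((Ω ^ᴬ r A.* w) A.* elements i ^ᴬ r A.≈ A.0#) ⊎
               ((Ω ^ᴬ r A.* w) A.* elements i ^ᴬ r A.≈ Ω ^ᴬ r A.* w)) →
      ∃ IsPrimitive
    fromShrunk (w , e≉0 , idem , split) = e , e≉0 , idem
      , (λ y → [ (λ eq → inj₁ (A.trans (y≈ y) eq)) , (λ eq → inj₂ (A.trans (y≈ y) eq)) ]′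
                 (split (Inverse.to (FF.vectors r) y)))
      , Ω ^ᴬ s A.* w , A.*-assoc Ω (Ω ^ᴬ s) w
      where
      e = Ω ^ᴬ r A.* w
      y≈ : ∀ y → e A.* y ^ᴬ r A.≈ e A.* elements (Inverse.to (FF.vectors r) y) ^ᴬ r
      y≈ y = A.*-congˡ {e} (^ᴬ-congˡ r (A.sym {elements (Inverse.to (FF.vectors r) y)} {y}
               (Inverse.strictlyInverseʳ (FF.vectors r) y)))

  -- Shrinking starts from `Ω ^ᴬ r`, an idempotent that is nonzero because `Ω` is.
  primitiveIdempotent : ∃ IsPrimitive
  primitiveIdempotent = fromShrunk (shrink elements (Ω ^ᴬ r) (^-idempotent Ω) (noSmallerPeriod≉0 ∘ ^-zero))

  -- The field cut out by a primitive idempotent, and its Hankel matrices.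

  module Spread (e : A.Carrier) (e-primitive : IsPrimitive e) where
    e≉0 : ¬ e A.≈ A.0#
    e≉0 = proj₁ e-primitive

    e-idempotent : e A.* e A.≈ e
    e-idempotent = proj₁ (proj₂ e-primitive)

    split : ∀ y → (e A.* y ^ᴬ r A.≈ A.0#) ⊎ (e A.* y ^ᴬ r A.≈ e)
    split = proj₁ (proj₂ (proj₂ e-primitive))

    Ω-unit : ∃[ z ] e A.≈ Ω A.* z
    Ω-unit = proj₂ (proj₂ (proj₂ e-primitive))

    open SemiringSum semiring
    open Corner algebra e public
    module K = CommutativeRing corner
    open Exp K.semiring using () renaming (_^_ to _^ᴷ_)

    -- Not definitional: _^_ depends on the equality of the ring through its raw monoid.
    ^ᴷ≡^ : ∀ y m → y ^ᴷ m ≡ y ^ᴬ m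
    ^ᴷ≡^ y zero    = ≡.refl
    ^ᴷ≡^ y (suc m) = ≡.cong (y A.*_) (^ᴷ≡^ y m)

    ^-cong-∼ : ∀ m x y → x ∼ y → x ^ᴬ m ∼ y ^ᴬ m
    ^-cong-∼ zero    x y x∼y = A.refl
    ^-cong-∼ (suc m) x y x∼y = K.*-cong {x} {y} {x ^ᴬ m} {y ^ᴬ m} x∼y (^-cong-∼ m x y x∼y)

    open SemiringSum K.semiring using () renaming (sum to sumᴷ)

    e*-∼ : ∀ y → e A.* y ∼ y
    e*-∼ y = A.trans (A.sym (A.*-assoc e e y)) (A.*-congʳ {y} e-idempotent)

    1≁0 : ¬ A.1# ∼ A.0#
    1≁0 eq = e≉0 (A.trans (A.sym (A.*-identityʳ e)) (A.trans eq (A.zeroʳ e)))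

    -- By primitivity `e` kills or fixes `y ^ᴬ r`. Killing it would kill `y` as well, because `y`
    -- equals `y A.* y ^ᴬ r`.
    ∼-inverse : ∀ {y} → ¬ y ∼ A.0# → y A.* y ^ᴬ s ∼ A.1#
    ∼-inverse {y} y≁0 with split y
    ... | inj₂ eq = A.trans eq (A.sym (A.*-identityʳ e))
    ... | inj₁ eq = contradiction (K.trans {y} {y A.* y ^ᴬ r} {A.0#} (≈⇒∼ (A.sym (periodic y)))
          (K.trans {y A.* y ^ᴬ r} {y A.* A.0#} {A.0#}
            (K.*-congˡ {y} {y ^ᴬ r} {A.0#} (A.trans eq (A.sym (A.zeroʳ e)))) (≈⇒∼ (A.zeroʳ y)))) y≁0

    ∼-cancel : ∀ {y} u v → ¬ y ∼ A.0# → u A.* y ∼ v A.* y → u ∼ v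
    ∼-cancel {y} u v y≁0 eq = begin
      u                        ≈⟨ restore u ⟨
      u A.* y A.* y ^ᴬ s       ≈⟨ K.*-congʳ {y ^ᴬ s} {u A.* y} {v A.* y} eq ⟩
      v A.* y A.* y ^ᴬ s       ≈⟨ restore v ⟩
      v                        ∎
      where
      open ≈-Reasoning K.setoid
      restore : ∀ u → u A.* y A.* y ^ᴬ s ∼ u
      restore u = begin
        u A.* y A.* y ^ᴬ s     ≈⟨ K.*-assoc u y (y ^ᴬ s) ⟩
        u A.* (y A.* y ^ᴬ s)   ≈⟨ K.*-congˡ {u} {y A.* y ^ᴬ s} {A.1#} (∼-inverse {y} y≁0) ⟩
        u A.* A.1#             ≈⟨ K.*-identityʳ u ⟩
        u                      ∎

    ∼-integral : ∀ x y → x A.* y ∼ A.0# → ¬ x ∼ A.0# → y ∼ A.0#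
    ∼-integral x y xy∼0 x≁0 = ∼-cancel {x} y A.0# x≁0 (begin
      y A.* x      ≈⟨ K.*-comm y x ⟩
      x A.* y      ≈⟨ xy∼0 ⟩
      A.0#         ≈⟨ K.zeroˡ x ⟨
      A.0# A.* x   ∎)
      where open ≈-Reasoning K.setoid

    open Roots corner ∼-integral

    -- `e` is a multiple of `Ω` and represents the unit of the corner.
    noSmallerPeriod≁0 : ¬ Ω ∼ A.0#
    noSmallerPeriod≁0 eq = 1≁0 (begin
      A.1#          ≈⟨ A.trans (A.*-identityʳ e) (A.sym e-idempotent) ⟩
      e             ≈⟨ ≈⇒∼ (proj₂ Ω-unit) ⟩
      Ω A.* z       ≈⟨ K.*-congʳ {z} {Ω} {A.0#} eq ⟩
      A.0# A.* z    ≈⟨ K.zeroˡ z ⟩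
      A.0#          ∎)
      where
      open ≈-Reasoning K.setoid
      z = proj₁ Ω-unit

    period-zero : ∀ m d → suc d ℕ.≤ m → x^ (ℕ.pred (q ℕ.^ suc d)) ∼ A.1# → noSmallerPeriod m ∼ A.0#
    period-zero (suc m) d (ℕ.s≤s d≤m) eq with ℕ.m≤n⇒m<n∨m≡n d≤m
    ... | inj₁ d<m = K.trans {noSmallerPeriod (suc m)} {factor A.* A.0#} {A.0#}
          (K.*-congˡ {factor} {noSmallerPeriod m} {A.0#} (period-zero m d d<m eq)) (K.zeroʳ factor)
      where factor = x^ (ℕ.pred (q ℕ.^ suc m)) A.- A.1#
    ... | inj₂ ≡.refl = K.trans {noSmallerPeriod (suc m)} {A.0# A.* noSmallerPeriod m} {A.0#}
          (K.*-congʳ {noSmallerPeriod m} {x^ (ℕ.pred (q ℕ.^ suc m)) A.- A.1#} {A.0#}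
            (Sums.x≈y⇒x-y≈0 corner {x^ (ℕ.pred (q ℕ.^ suc m))} {A.1#} eq))
          (K.zeroˡ (noSmallerPeriod m))

    -- Raising an equality to the power `q ^ (n - i)` turns the left side into `t` and the right
    -- side into `t^Q` with `Q = q ^ suc d`. Then `t^(Q - 1) = 1`, and a factor of `Ω` vanishes.
    x^-q^-distinct : ∀ i d → i ℕ.+ suc d ℕ.< n → ¬ x^ (q ℕ.^ i) ∼ x^ (q ℕ.^ (i ℕ.+ suc d))
    x^-q^-distinct i d i+1+d<n eq = noSmallerPeriod≁0 (period-zero n-1 d
      (ℕ.≤-pred (ℕ.≤-<-trans (ℕ.m≤n+m (suc d) i) i+1+d<n))
      -- As `r = suc s`, the element `x^ s` is the inverse of `t`; it divides `x^ Q ∼ x^ 1` by `t`.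
      (begin
        x^ (ℕ.pred Q)              ≈⟨ ≈⇒∼ (x^-+r (ℕ.pred Q)) ⟨
        x^ (ℕ.pred Q ℕ.+ r)        ≈⟨ ≈⇒∼ (A.reflexive (≡.cong x^ (≡.trans (ℕ.+-suc (ℕ.pred Q) s)
                                        (≡.cong (ℕ._+ s) (ℕ.suc-pred Q {{ℕ.m^n≢0 q (suc d)}}))))) ⟩
        x^ (Q ℕ.+ s)               ≈⟨ ≈⇒∼ (x^-+ Q s) ⟨
        x^ Q A.* x^ s              ≈⟨ K.*-congʳ {x^ s} {x^ Q} {x^ 1} x^Q∼x ⟩
        x^ 1 A.* x^ s              ≈⟨ ≈⇒∼ (A.trans (x^-+ 1 s) (x^-+r 0)) ⟩
        A.1#                       ∎))
      where
      open ≈-Reasoning K.setoid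
      Q = q ℕ.^ suc d
      t = n ℕ.∸ i
      i+t≡n : i ℕ.+ t ≡ n
      i+t≡n = ℕ.m+[n∸m]≡n (ℕ.≤-trans (ℕ.m≤m+n i (suc d)) (ℕ.<⇒≤ i+1+d<n))
      raise : ∀ i′ → x^ (q ℕ.^ i′) ^ᴬ (q ℕ.^ t) ∼ x^ (q ℕ.^ (i′ ℕ.+ t))
      raise i′ = ≈⇒∼ (A.trans (x^-^ (q ℕ.^ i′) (q ℕ.^ t))
                       (A.reflexive (≡.cong x^ (≡.sym (ℕ.^-distribˡ-+-* q i′ t)))))
      exponent : i ℕ.+ suc d ℕ.+ t ≡ suc d ℕ.+ n
      exponent = ≡.trans (≡.cong (ℕ._+ t) (ℕ.+-comm i (suc d)))
                   (≡.trans (ℕ.+-assoc (suc d) i t) (≡.cong (suc d ℕ.+_) i+t≡n))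
      x^Q∼x : x^ Q ∼ x^ 1
      x^Q∼x = begin
        x^ Q                                     ≈⟨ ≈⇒∼ (x^-q^n Q) ⟨
        x^ (Q ℕ.* q ℕ.^ n)                       ≈⟨ ≈⇒∼ (A.reflexive (≡.cong x^ (≡.trans
                                                      (≡.sym (ℕ.^-distribˡ-+-* q (suc d) n))
                                                      (≡.cong (q ℕ.^_) (≡.sym exponent))))) ⟩
        x^ (q ℕ.^ (i ℕ.+ suc d ℕ.+ t))           ≈⟨ raise (i ℕ.+ suc d) ⟨
        x^ (q ℕ.^ (i ℕ.+ suc d)) ^ᴬ (q ℕ.^ t)    ≈⟨ ^-cong-∼ (q ℕ.^ t) (x^ (q ℕ.^ i)) (x^ (q ℕ.^ (i ℕ.+ suc d))) eq ⟨
        x^ (q ℕ.^ i) ^ᴬ (q ℕ.^ t)                ≈⟨ raise i ⟩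
        x^ (q ℕ.^ (i ℕ.+ t))                     ≈⟨ ≈⇒∼ (A.reflexive (≡.cong x^ (≡.trans (≡.cong (q ℕ.^_) i+t≡n)
                                                      (≡.sym (ℕ.*-identityˡ (q ℕ.^ n)))))) ⟩
        x^ (1 ℕ.* q ℕ.^ n)                       ≈⟨ ≈⇒∼ (x^-q^n 1) ⟩
        x^ 1                                     ∎

    conjugate : Fin n → A.Carrier
    conjugate j = x^ (q ℕ.^ toℕ j)

    conjugate-< : ∀ {i j : Fin n} → toℕ i ℕ.< toℕ j → ¬ conjugate i ∼ conjugate j
    conjugate-< {i} {j} i<j eq = x^-q^-distinct (toℕ i) (ℕ.pred d)
      (≡.subst (ℕ._< n) (≡.sym j≡) (Fin.toℕ<n j))
      (A.trans eq (A.reflexive (≡.cong (λ m → e A.* x^ (q ℕ.^ m)) (≡.sym j≡))))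
      where
      d = toℕ j ℕ.∸ toℕ i
      j≡ : toℕ i ℕ.+ suc (ℕ.pred d) ≡ toℕ j
      j≡ = ≡.trans (≡.cong (toℕ i ℕ.+_) (ℕ.suc-pred d {{ℕ.>-nonZero (ℕ.m<n⇒0<n∸m i<j)}}))
                   (ℕ.m+[n∸m]≡n (ℕ.<⇒≤ i<j))

    conjugate-distinct : ∀ {i j} → i ≢ j → ¬ conjugate i ∼ conjugate j
    conjugate-distinct {i} {j} i≢j eq with ℕ.<-cmp (toℕ i) (toℕ j)
    ... | tri< i<j _ _ = conjugate-< i<j eq
    ... | tri≈ _ i≡j _ = i≢j (Fin.toℕ-injective i≡j)
    ... | tri> _ _ j<i = conjugate-< j<i (A.sym eq)

    ⟦_⟧ : Vector Carrier n → A.Carrier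
    ⟦ v ⟧ = combination v toℕ

    -- A nonzero scalar is invertible, so it cannot vanish in a ring where `1` differs from `0`.
    constant-∼0 : ∀ {y} → constant y ∼ A.0# → y ≈ 0#
    constant-∼0 {y} eq with y FF.≈? 0#
    ... | yes y≈0 = y≈0
    ... | no  y≉0 with z , yz≈1 ← inverse y y≉0 = contradiction (begin
      A.1#                        ≈⟨ ≈⇒∼ (single-cong _ yz≈1) ⟨
      constant (y * z)            ≈⟨ ≈⇒∼ (constant-* y z) ⟩
      constant y A.* constant z   ≈⟨ K.*-congʳ {constant z} {constant y} {A.0#} eq ⟩
      A.0# A.* constant z         ≈⟨ K.zeroˡ (constant z) ⟩
      A.0#                        ∎) 1≁0
      where open ≈-Reasoning K.setoid

    -- Powers of Frobenius carry the relation from `t` to all its conjugates. The polynomial with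
    -- coefficients `u i - v i` thus has `n` distinct roots and only `n` coefficients.
    ⟦⟧-injective : ∀ u v → ⟦ u ⟧ ∼ ⟦ v ⟧ → ∀ i → u i ≈ v i
    ⟦⟧-injective u v eq i = Sums.x-y≈0⇒x≈y F (constant-∼0
      (zero-of-many-roots (λ i → constant (u i - v i)) conjugate conjugate-distinct root i))
      where
      open ≈-Reasoning K.setoid
      conj : Vector Carrier n → Fin n → A.Carrier
      conj v j = combination v (λ i → toℕ i ℕ.* q ℕ.^ toℕ j)
      conj-cong : ∀ j → conj u j ∼ conj v j
      conj-cong j = begin
        conj u j                    ≈⟨ ≈⇒∼ (frobenius-combination u toℕ (toℕ j)) ⟨
        ⟦ u ⟧ ^ᴬ (q ℕ.^ toℕ j)      ≈⟨ ^-cong-∼ (q ℕ.^ toℕ j) ⟦ u ⟧ ⟦ v ⟧ eq ⟩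
        ⟦ v ⟧ ^ᴬ (q ℕ.^ toℕ j)      ≈⟨ ≈⇒∼ (frobenius-combination v toℕ (toℕ j)) ⟩
        conj v j                    ∎
      term : ∀ j i → constant (u i - v i) A.* conjugate j ^ᴬ toℕ i A.≈
        (constant (u i) A.* x^ (toℕ i ℕ.* q ℕ.^ toℕ j)) A.- (constant (v i) A.* x^ (toℕ i ℕ.* q ℕ.^ toℕ j))
      term j i = A.trans
        (A.*-cong (constant-minus (u i) (v i)) (A.trans (x^-^ (q ℕ.^ toℕ j) (toℕ i))
          (A.reflexive (≡.cong x^ (ℕ.*-comm (q ℕ.^ toℕ j) (toℕ i))))))
        (A.trans (A.distribʳ m (constant (u i)) (A.- constant (v i)))
                 (A.+-congˡ {constant (u i) A.* m} (A.sym (RingProperties.-‿distribˡ-* A.ring (constant (v i)) m))))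
        where m = x^ (toℕ i ℕ.* q ℕ.^ toℕ j)
      root : ∀ j → eval (λ i → constant (u i - v i)) (conjugate j) ∼ A.0#
      root j = begin
        eval (λ i → constant (u i - v i)) (conjugate j)
          ≈⟨ eval≈sum (λ i → constant (u i - v i)) (conjugate j) ⟩
        sumᴷ (λ i → constant (u i - v i) A.* conjugate j ^ᴷ toℕ i)
          ≡⟨ SemiringSum.sum-cong-≗ A.semiring {n} (λ i → ≡.cong (constant (u i - v i) A.*_) (^ᴷ≡^ (conjugate j) (toℕ i))) ⟩
        sumᴬ (λ i → constant (u i - v i) A.* conjugate j ^ᴬ toℕ i)
          ≈⟨ ≈⇒∼ (A.trans (ASum.sum-cong-≋ {n} (term j)) (Sums.sum-minus algebra {n}
               (λ i → constant (u i) A.* x^ (toℕ i ℕ.* q ℕ.^ toℕ j))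
               (λ i → constant (v i) A.* x^ (toℕ i ℕ.* q ℕ.^ toℕ j)))) ⟩
        conj u j A.- conj v j
          ≈⟨ Sums.x≈y⇒x-y≈0 corner {conj u j} {conj v j} (conj-cong j) ⟩
        A.0# ∎

    combination-congˡ : ∀ {m} {u v : Vector Carrier m} d → (∀ i → u i ≈ v i) →
                        combination u d A.≈ combination v d
    combination-congˡ {m} d u≈v =
      ASum.sum-cong-≋ {m} (λ i → A.*-congʳ {x^ (d i)} (single-cong (0 mod r) (u≈v i)))

    -- There are q^n combinations, and as many roots of y^(q^n) = y.
    spanning : ∀ y → ∃[ v ] ⟦ v ⟧ ∼ y
    spanning y = found (Finite.∃? vectors {P = λ v → ⟦ v ⟧ ∼ y}
      (λ {u} {v} u≈v eq → A.trans (≈⇒∼ {⟦ v ⟧} {⟦ u ⟧} (combination-congˡ toℕ (λ i → sym (u≈v i)))) eq)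
      (λ v → (e A.* ⟦ v ⟧) ≈ᴬ? (e A.* y)))
      where
      vectors : HasCardinality (VecEq.≋-setoid setoid n) (suc r)
      vectors = ≡.subst (HasCardinality _) q^n≡1+r (FF.vectors n)
      found : Dec (∃[ v ] ⟦ v ⟧ ∼ y) → ∃[ v ] ⟦ v ⟧ ∼ y
      found (yes some) = some
      found (no none)  = contradiction (periodic-bound s ρ distinct
          (λ i → ≈⇒∼ (A.trans (A.reflexive (^ᴷ≡^ (ρ i) (suc r))) (periodic (ρ i))))) 1≁0
        where
        -- All `q ^ n = suc r` combinations, and `y` as one root too many.
        ρ : Vector A.Carrier (suc (suc r))
        ρ zero    = y
        ρ (suc i) = ⟦ Inverse.from vectors i ⟧
        distinct : ∀ {i j} → i ≢ j → ¬ ρ i ∼ ρ j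
        distinct {zero}  {zero}  i≢j eq = i≢j ≡.refl
        distinct {zero}  {suc j} i≢j eq = none (Inverse.from vectors j , A.sym eq)
        distinct {suc i} {zero}  i≢j eq = none (Inverse.from vectors i , eq)
        distinct {suc i} {suc j} i≢j eq = i≢j (≡.cong suc (Finite.from-injective vectors
          (⟦⟧-injective (Inverse.from vectors i) (Inverse.from vectors j) eq)))

    -- The coefficient of `t^0`, used as the linear form behind the Hankel matrices.
    ϕ : A.Carrier → Carrier
    ϕ f = f (0 mod r)

    ϕ-combination : ∀ y {m} (v : Vector Carrier m) d →
                    ϕ (y A.* combination v d) ≈ ∑[ i < m ] (v i * ϕ (y A.* x^ (d i)))
    ϕ-combination y {m} v d = begin
      ϕ (y A.* combination v d)
        ≈⟨ ASum.*-distribˡ-sum {m} y (λ i → constant (v i) A.* x^ (d i)) (0 mod r) ⟩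
      ϕ (sumᴬ (λ i → y A.* (constant (v i) A.* x^ (d i))))
        ≈⟨ sum-at {m} (λ i → y A.* (constant (v i) A.* x^ (d i))) (0 mod r) ⟩
      ∑[ i < m ] ϕ (y A.* (constant (v i) A.* x^ (d i)))
        ≈⟨ sum-cong-≋ {m} (λ i → trans (swap i (0 mod r)) (constant-⋆ (v i) (y A.* x^ (d i)) (0 mod r))) ⟩
      ∑[ i < m ] (v i * ϕ (y A.* x^ (d i))) ∎
      where
      open ≈-Reasoning setoid
      swap : ∀ i → y A.* (constant (v i) A.* x^ (d i)) A.≈ constant (v i) A.* (y A.* x^ (d i))
      swap i = A.trans (A.sym (A.*-assoc y (constant (v i)) (x^ (d i))))
        (A.trans (A.*-congʳ {x^ (d i)} (A.*-comm y (constant (v i)))) (A.*-assoc (constant (v i)) y (x^ (d i))))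

    -- For `y` in the ideal of `e`, replacing `x^ m` by a combination equal to it in the corner does
    -- not change the product with `y`.
    ϕ-determined : ∀ y → e A.* y A.≈ y → ∀ m (v : Vector Carrier n) → ⟦ v ⟧ ∼ x^ m →
                   ϕ (y A.* x^ m) ≈ ∑[ i < n ] (v i * ϕ (y A.* x^ (toℕ i)))
    ϕ-determined y ey≈y m v v∼x^m = begin
      ϕ (y A.* x^ m)                             ≈⟨ absorb (x^ m) (0 mod r) ⟨
      ϕ (y A.* (e A.* x^ m))                     ≈⟨ A.*-congˡ {y} v∼x^m (0 mod r) ⟨
      ϕ (y A.* (e A.* ⟦ v ⟧))                    ≈⟨ absorb ⟦ v ⟧ (0 mod r) ⟩
      ϕ (y A.* ⟦ v ⟧)                            ≈⟨ ϕ-combination y v toℕ ⟩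
      ∑[ i < n ] (v i * ϕ (y A.* x^ (toℕ i)))    ∎
      where
      open ≈-Reasoning setoid
      absorb : ∀ z → y A.* (e A.* z) A.≈ y A.* z
      absorb z = A.trans (A.sym (A.*-assoc y e z))
        (A.*-congʳ {z} (A.trans (A.*-comm y e) ey≈y))

    -- The coefficient at `k` is `ϕ` of the product with the inverse of `k`, and by `ϕ-determined`
    -- this depends only on the first `n` moments.
    ϕ-nondegenerate : ∀ y z → e A.* y A.≈ y → e A.* z A.≈ z →
                      (∀ (i : Fin n) → ϕ (y A.* x^ (toℕ i)) ≈ ϕ (z A.* x^ (toℕ i))) → y A.≈ z
    ϕ-nondegenerate y z ey≈y ez≈z eq k = begin
      y k                         ≈⟨ at y ⟩
      ϕ (y A.* x^ (toℕ (⊖ k)))    ≈⟨ moments {toℕ (⊖ k)} (spanning (x^ (toℕ (⊖ k)))) ⟩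
      ϕ (z A.* x^ (toℕ (⊖ k)))    ≈⟨ at z ⟨
      z k                         ∎
      where
      open ≈-Reasoning setoid
      at : ∀ y → y k ≈ ϕ (y A.* x^ (toℕ (⊖ k)))
      at y = trans (coefficient-at y k) (A.*-congˡ {y} (basis-x^ (⊖ k)) (0 mod r))
      moments : ∀ {m} → ∃[ v ] ⟦ v ⟧ ∼ x^ m → ϕ (y A.* x^ m) ≈ ϕ (z A.* x^ m)
      moments {m} (v , v∼x^m) = trans (ϕ-determined y ey≈y m v v∼x^m)
        (trans (sum-cong-≋ {n} (λ i → *-congˡ {v i} (eq i))) (sym (ϕ-determined z ez≈z m v v∼x^m)))

    -- The factor `e` moves `⟦ v ⟧` into the ideal of `e`, where finitely many moments determine an
    -- element.
    hankel : Vector Carrier n → ℕ → Carrier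
    hankel v m = ϕ (e A.* ⟦ v ⟧ A.* x^ m)

    -- The Hankel matrix of `u` is multiplication by `⟦ u ⟧` in the field, with the result recorded
    -- by its moments.
    hankel-action : ∀ u y (i : Fin n) → ∑[ j < n ] (hankel u (toℕ i ℕ.+ toℕ j) * y j)
                                      ≈ ϕ (e A.* (⟦ u ⟧ A.* ⟦ y ⟧) A.* x^ (toℕ i))
    hankel-action u y i = begin
      ∑[ j < n ] (hankel u (toℕ i ℕ.+ toℕ j) * y j)
        ≈⟨ sum-cong-≋ {n} (λ j → trans (*-comm _ (y j)) (*-congˡ (A.trans
             (A.*-congˡ {Y} (A.sym (x^-+ (toℕ i) (toℕ j))))
             (A.sym (A.*-assoc Y (x^ (toℕ i)) (x^ (toℕ j)))) (0 mod r)))) ⟩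
      ∑[ j < n ] (y j * ϕ (Y A.* x^ (toℕ i) A.* x^ (toℕ j)))
        ≈⟨ ϕ-combination (Y A.* x^ (toℕ i)) y toℕ ⟨
      ϕ (Y A.* x^ (toℕ i) A.* ⟦ y ⟧)
        ≈⟨ A.trans (A.*-assoc Y (x^ (toℕ i)) ⟦ y ⟧) (A.trans (A.*-congˡ {Y} (A.*-comm (x^ (toℕ i)) ⟦ y ⟧))
           (A.trans (A.sym (A.*-assoc Y ⟦ y ⟧ (x^ (toℕ i))))
             (A.*-congʳ {x^ (toℕ i)} (A.*-assoc e ⟦ u ⟧ ⟦ y ⟧)))) (0 mod r) ⟩
      ϕ (e A.* (⟦ u ⟧ A.* ⟦ y ⟧) A.* x^ (toℕ i)) ∎
      where
      open ≈-Reasoning setoid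
      Y = e A.* ⟦ u ⟧

    ⟦⟧-nonzero : ∀ y → ¬ (∀ i → y i ≈ 0#) → ¬ ⟦ y ⟧ ∼ A.0#
    ⟦⟧-nonzero y y≉0 eq = y≉0 (⟦⟧-injective y (λ _ → 0#) (A.trans eq (≈⇒∼ {A.0#} {⟦ (λ _ → 0#) ⟧} (A.sym
      (Sums.sum-zero algebra {n} (λ i → constant 0# A.* x^ (toℕ i))
        (λ i → A.trans (A.*-congʳ {x^ (toℕ i)} constant-0) (A.zeroˡ (x^ (toℕ i)))))))))

    spreadSet : SpreadSet F n
    spreadSet = record
      { matrix      = λ v i j → hankel v (toℕ i ℕ.+ toℕ j)
      ; matrix-cong = λ {u} {v} u≈v i j → A.*-congʳ {x^ (toℕ i ℕ.+ toℕ j)}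
          (A.*-congˡ {e} (combination-congˡ toℕ u≈v)) (0 mod r)
      ; symmetric   = λ v i j → reflexive (≡.cong (hankel v) (ℕ.+-comm (toℕ i) (toℕ j)))
      -- Equal moments give `⟦ u ⟧ A.* ⟦ y ⟧ ∼ ⟦ v ⟧ A.* ⟦ y ⟧`, and the nonzero factor `⟦ y ⟧`
      -- cancels.
      ; injective   = λ y y≉0 u v eq → ⟦⟧-injective u v (∼-cancel {⟦ y ⟧} ⟦ u ⟧ ⟦ v ⟧ (⟦⟧-nonzero y y≉0)
          (ϕ-nondegenerate (e A.* (⟦ u ⟧ A.* ⟦ y ⟧)) (e A.* (⟦ v ⟧ A.* ⟦ y ⟧))
            (e*-∼ (⟦ u ⟧ A.* ⟦ y ⟧)) (e*-∼ (⟦ v ⟧ A.* ⟦ y ⟧))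
            (λ i → trans (sym (hankel-action u y i)) (trans (eq i) (hankel-action v y i)))))
      }

-- Isotropic families

module AlternatingForm (F : CommutativeRing c ℓ) where
  open CommutativeRing F hiding (zero)
  open SemiringSum semiring
  open Sums F
  open ≈-Reasoning setoid

  private
    minus-interchange : ∀ x y z w → (x - y) - (z - w) ≈ (x - z) - (y - w)
    minus-interchange x y z w = begin
      (x - y) - (z - w)       ≈⟨ +-congˡ (-‿+-comm z (- w)) ⟨
      (x - y) + (- z - - w)   ≈⟨ interchange x (- y) (- z) (- - w) ⟩
      (x - z) + (- y - - w)   ≈⟨ +-congˡ (-‿+-comm y (- w)) ⟩
      (x - z) - (y - w)       ∎
      where
      open RingProperties ring using (-‿+-comm)
      open CommutativeSemigroupProperties (CommutativeMonoid.commutativeSemigroup +-commutativeMonoid) using (interchange)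

  open RingProperties ring using (x[y-z]≈xy-xz; [y-z]x≈yx-zx)

  -- Coordinates grouped by hyperbolic plane.
  Point : ℕ → Set c
  Point ν = Fin ν → Fin 2 → Carrier

  ω : ∀ {ν} → Point ν → Point ν → Carrier
  ω {ν} u v = ∑[ b < ν ] (u b 0F * v b 1F - u b 1F * v b 0F)

  _∸ᵖ_ : ∀ {ν} → Point ν → Point ν → Point ν
  (u ∸ᵖ v) b s = u b s - v b s

  ω-minusˡ : ∀ {ν} (u u′ v : Point ν) → ω (u ∸ᵖ u′) v ≈ ω u v - ω u′ v
  ω-minusˡ {ν} u u′ v = trans
    (sum-cong-≋ {ν} (λ b →
      trans (+-cong ([y-z]x≈yx-zx _ _ _) (-‿cong ([y-z]x≈yx-zx _ _ _))) (minus-interchange _ _ _ _)))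
    (sum-minus {ν} _ _)

  ω-minusʳ : ∀ {ν} (u v v′ : Point ν) → ω u (v ∸ᵖ v′) ≈ ω u v - ω u v′
  ω-minusʳ {ν} u v v′ = trans
    (sum-cong-≋ {ν} (λ b →
      trans (+-cong (x[y-z]≈xy-xz _ _ _) (-‿cong (x[y-z]≈xy-xz _ _ _))) (minus-interchange _ _ _ _)))
    (sum-minus {ν} _ _)

  0-0≈0 : ∀ {x y} → x ≈ 0# → y ≈ 0# → x - y ≈ 0#
  0-0≈0 x≈0 y≈0 = x≈y⇒x-y≈0 (trans x≈0 (sym y≈0))

  ω-zeroʳ : ∀ {ν} (u v : Point ν) → (∀ b s → v b s ≈ 0#) → ω u v ≈ 0#
  ω-zeroʳ {ν} u v v≈0 = sum-zero {ν} _ (λ b →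
    0-0≈0 (trans (*-congˡ (v≈0 b 1F)) (zeroʳ _)) (trans (*-congˡ (v≈0 b 0F)) (zeroʳ _)))

  ω-zeroˡ : ∀ {ν} (u v : Point ν) → (∀ b s → u b s ≈ 0#) → ω u v ≈ 0#
  ω-zeroˡ {ν} u v u≈0 = sum-zero {ν} _ (λ b →
    0-0≈0 (trans (*-congʳ (u≈0 b 0F)) (zeroˡ _)) (trans (*-congʳ (u≈0 b 1F)) (zeroˡ _)))

  ω-tail : ∀ {ν} (u v : Point (suc ν)) → u 0F 0F ≈ 0# → v 0F 0F ≈ 0# →
           ω u v ≈ ω (u ∘ suc) (v ∘ suc)
  ω-tail u v u≈0 v≈0 = trans (+-congʳ
    (0-0≈0 (trans (*-congʳ u≈0) (zeroˡ _)) (trans (*-congˡ v≈0) (zeroʳ _)))) (+-identityˡ _)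

module Isotropic
  (F : CommutativeRing c ℓ) (inverse : NonzeroInvertible F)
  {q-2 : ℕ} (card : HasCardinality (CommutativeRing.setoid F) (suc (suc q-2)))
  where
  open CommutativeRing F hiding (zero)
  private
    q : ℕ
    q = suc (suc q-2)

  open FiniteField F inverse card
  open Inverse card using (to)
  open AlternatingForm F
  open SemiringSum semiring
  open Sums F

  -- Bounds the number of distinct values of `g` by `Q`, while the family itself may have
  -- repetitions.
  Separates : ∀ {ν m Q} → (Fin m → Point ν) → (Fin m → Fin Q) → Set ℓ
  Separates g code = ∀ i j → code i ≡ code j → ∀ b s → g i b s ≈ g j b s

  module Step {ν m} (g : Fin m → Point (suc ν)) (g⊥g : ∀ i j → ω (g i) (g j) ≈ 0#)
    (rec : (h : Fin m → Point ν) → (∀ i j → ω (h i) (h j) ≈ 0#) →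
           ∃[ code ] Separates {Q = q ℕ.^ ν} h code) where

    key : Fin m → Fin q
    key i = to (g i 0F 0F)

    -- The fallback `i` only makes the function total: in `rep` the search always succeeds, as `i`
    -- has its own key.
    pick : ∀ {t} → Dec (∃[ j ] key j ≡ t) → Fin m → Fin m
    pick (yes (j , _)) _ = j
    pick (no _)        i = i

    rep : Fin m → Fin m
    rep i = pick (Fin.any? (λ j → key j Fin.≟ key i)) i

    key-rep : ∀ i → key (rep i) ≡ key i
    key-rep i = go (Fin.any? (λ j → key j Fin.≟ key i))
      where
      go : (d : Dec (∃[ j ] key j ≡ key i)) → key (pick d i) ≡ key i
      go (yes (j , eq)) = eq
      go (no none)      = ≡.refl

    rep-cong : ∀ {i j} → key i ≡ key j → rep i ≡ rep j
    rep-cong {i} {j} eq = ≡.trans (≡.cong (λ t → pick (Fin.any? (λ j → key j Fin.≟ t)) i) eq)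
                                  (go (Fin.any? (λ j′ → key j′ Fin.≟ key j)))
      where
      go : (d : Dec (∃[ j′ ] key j′ ≡ key j)) → pick d i ≡ pick d j
      go (yes _)   = ≡.refl
      go (no none) = contradiction (j , ≡.refl) none

    d : Fin m → Point (suc ν)
    d i = g i ∸ᵖ g (rep i)

    g⊥d : ∀ i j → ω (g i) (d j) ≈ 0#
    g⊥d i j = trans (ω-minusʳ (g i) (g j) (g (rep j))) (0-0≈0 (g⊥g i j) (g⊥g i (rep j)))

    d⊥d : ∀ i j → ω (d i) (d j) ≈ 0#
    d⊥d i j = trans (ω-minusˡ (g i) (g (rep i)) (d j)) (0-0≈0 (g⊥d i j) (g⊥d (rep i) j))

    d₀₀≈0 : ∀ i → d i 0F 0F ≈ 0#
    d₀₀≈0 i = x≈y⇒x-y≈0 (to-injective (≡.sym (key-rep i)))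

    -- The first coordinate of every `d i` is zero, so dropping the first plane can lose only the
    -- coordinate at `0F 1F`; a collision is such a loss.
    Collision : Fin m → Fin m → Set ℓ
    Collision i j = (∀ b s → d i (suc b) s ≈ d j (suc b) s) ∧ (¬ d i 0F 1F ≈ d j 0F 1F)

    collision? : Dec (∃[ i ] ∃[ j ] Collision i j)
    collision? = Fin.any? (λ i → Fin.any? (λ j →
      Fin.all? (λ b → Fin.all? (λ s → d i (suc b) s ≈? d j (suc b) s)) ×-dec ¬? (d i 0F 1F ≈? d j 0F 1F)))

    -- A collision yields a vector of the span supported on the second
    -- coordinate alone, so the first coordinate vanishes on the whole family.
    collision⇒₀₀≈0 : ∃[ i ] ∃[ j ] Collision i j → ∀ k → g k 0F 0F ≈ 0#
    collision⇒₀₀≈0 (i , j , tails , heads) k =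
      integral y (g k 0F 0F) (trans (*-comm _ _) (trans (sym ω≈) ω≈0)) (heads ∘ x-y≈0⇒x≈y)
      where
      δ = d i ∸ᵖ d j
      y = δ 0F 1F
      ω≈0 : ω (g k) δ ≈ 0#
      ω≈0 = trans (ω-minusʳ (g k) (d i) (d j)) (0-0≈0 (g⊥d k i) (g⊥d k j))
      ω≈ : ω (g k) δ ≈ g k 0F 0F * y
      ω≈ = trans (+-cong
        (trans (+-congˡ (trans (-‿cong (trans (*-congˡ (0-0≈0 (d₀₀≈0 i) (d₀₀≈0 j))) (zeroʳ _))) -0#≈0#)) (+-identityʳ _))
        (ω-zeroʳ (g k ∘ suc) (δ ∘ suc) (λ b s → x≈y⇒x-y≈0 (tails b s)))) (+-identityʳ _)
        where open RingProperties ring using (-0#≈0#)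

    -- The first coordinate is zero throughout, so the second one takes its place in the code.
    extend-collision : ∃[ i ] ∃[ j ] Collision i j →
      ∃[ code ] Separates {Q = q ℕ.^ ν} (λ i → g i ∘ suc) code →
      ∃[ code ] Separates {Q = q ℕ.^ suc ν} g code
    extend-collision coll (code′ , sep) = code , separates
      where
      code : Fin m → Fin (q ℕ.^ suc ν)
      code i = combine (to (g i 0F 1F)) (code′ i)
      separates : Separates g code
      separates i j eq 0F 0F = trans (collision⇒₀₀≈0 coll i) (sym (collision⇒₀₀≈0 coll j))
      separates i j eq 0F 1F = to-injective (Fin.combine-injectiveˡ _ (code′ i) _ (code′ j) eq)
      separates i j eq (suc b) s = sep i j (Fin.combine-injectiveʳ (to (g i 0F 1F)) _ (to (g j 0F 1F)) _ eq) b s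
    -- The first coordinate determines the representative, the tail determines the difference from
    -- it, and their sum is the original vector.
    extend-no-collision : ¬ (∃[ i ] ∃[ j ] Collision i j) →
      ∃[ code ] Separates {Q = q ℕ.^ ν} (λ i → d i ∘ suc) code →
      ∃[ code ] Separates {Q = q ℕ.^ suc ν} g code
    extend-no-collision ¬coll (code′ , sep) = code , separates
      where
      code : Fin m → Fin (q ℕ.^ suc ν)
      code i = combine (key i) (code′ i)
      separates : Separates g code
      separates i j eq b s = trans (sym (x-y+y (g i b s) (g (rep i) b s)))
        (trans (+-cong (same b s) (reflexive (≡.cong (λ k → g k b s) (rep-cong {i} {j} keys))))
               (x-y+y (g j b s) (g (rep j) b s)))
        where
        keys : key i ≡ key j
        keys = Fin.combine-injectiveˡ (key i) (code′ i) (key j) (code′ j) eq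
        tails : ∀ b s → d i (suc b) s ≈ d j (suc b) s
        tails = sep i j (Fin.combine-injectiveʳ (key i) (code′ i) (key j) (code′ j) eq)
        same : ∀ b s → d i b s ≈ d j b s
        same 0F 0F = trans (d₀₀≈0 i) (sym (d₀₀≈0 j))
        same 0F 1F = decidable-stable (d i 0F 1F ≈? d j 0F 1F) (λ ≉ → ¬coll (i , j , tails , ≉))
        same (suc b) s = tails b s

    step : Dec (∃[ i ] ∃[ j ] Collision i j) → ∃[ code ] Separates {Q = q ℕ.^ suc ν} g code
    step (yes coll) = extend-collision coll (rec (λ i → g i ∘ suc) (λ i j →
      trans (sym (ω-tail (g i) (g j) (collision⇒₀₀≈0 coll i) (collision⇒₀₀≈0 coll j))) (g⊥g i j)))
    step (no ¬coll) = extend-no-collision ¬coll (rec (λ i → d i ∘ suc) (λ i j →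
      trans (sym (ω-tail (d i) (d j) (d₀₀≈0 i) (d₀₀≈0 j))) (d⊥d i j)))

  isotropic-code : ∀ ν {m} (g : Fin m → Point ν) → (∀ i j → ω (g i) (g j) ≈ 0#) →
                   ∃[ code ] Separates {Q = q ℕ.^ ν} g code
  isotropic-code zero    g _   = (λ _ → zero) , λ _ _ _ ()
  isotropic-code (suc ν) g g⊥g = Step.step g g⊥g (isotropic-code ν) (Step.collision? g g⊥g (isotropic-code ν))

-- The symplectic graph

fieldRing : ∀ {ℓ₁ ℓ₂} → HeytingField c ℓ₁ ℓ₂ → CommutativeRing c ℓ₁
fieldRing F = HeytingCommutativeRing.commutativeRing (HeytingField.heytingCommutativeRing F)

module SymplecticForm {ℓ₁ ℓ₂} (F : HeytingField c ℓ₁ ℓ₂) (ν : ℕ) where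
  open Symplectic F ν
  open CommutativeRing (fieldRing F) hiding (zero)
  open SemiringSum semiring
  open Sums (fieldRing F)
  open AlternatingForm (fieldRing F)
  open RingProperties ring using (-‿distribˡ-*; -‿distribʳ-*)
  open ≈-Reasoning setoid

  point : RowVector → Point ν
  point α b s = α (combine b s)

  sum-pairs : ∀ ν (f : Vector Carrier (ν ℕ.* 2)) →
              sum f ≈ ∑[ b < ν ] (f (combine b 0F) + f (combine b 1F))
  sum-pairs zero    f = refl
  sum-pairs (suc ν) f = trans (sym (+-assoc _ _ _)) (+-congˡ (sum-pairs ν (λ i → f (suc (suc i)))))

  K-combine : ∀ b s b′ s′ → K (combine b s) (combine b′ s′) ≡ (if does (b Fin.≟ b′) then J s s′ else 0#)
  K-combine b s b′ s′ = ≡.cong₂ entry (Fin.remQuot-combine {ν} {2} b s) (Fin.remQuot-combine {ν} {2} b′ s′)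
    where
    entry : Fin ν ∧ Fin 2 → Fin ν ∧ Fin 2 → Carrier
    entry (b , s) (b′ , s′) = if does (b Fin.≟ b′) then J s s′ else 0#

  K-same : ∀ b s s′ → K (combine b s) (combine b s′) ≈ J s s′
  K-same b s s′ rewrite K-combine b s b s′ with b Fin.≟ b
  ... | yes _ = refl
  ... | no b≢b = contradiction ≡.refl b≢b

  K-other : ∀ {b b′} s s′ → b ≢ b′ → K (combine b s) (combine b′ s′) ≈ 0#
  K-other {b} {b′} s s′ b≢b′ rewrite K-combine b s b′ s′ with b Fin.≟ b′
  ... | yes b≡b′ = contradiction b≡b′ b≢b′
  ... | no _     = refl

  row : ∀ α b s → ∑[ i < ν ℕ.* 2 ] (α i * K i (combine b s))
                ≈ point α b 0F * J 0F s + point α b 1F * J 1F s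
  row α b s = begin
    ∑[ i < ν ℕ.* 2 ] (α i * K i (combine b s))
      ≈⟨ sum-pairs ν (λ i → α i * K i (combine b s)) ⟩
    ∑[ b′ < ν ] (point α b′ 0F * K (combine b′ 0F) (combine b s) + point α b′ 1F * K (combine b′ 1F) (combine b s))
      ≈⟨ sum-single {ν} _ b (λ b′ b′≢b → trans (+-cong
           (trans (*-congˡ (K-other 0F s b′≢b)) (zeroʳ _))
           (trans (*-congˡ (K-other 1F s b′≢b)) (zeroʳ _))) (+-identityʳ 0#)) ⟩
    point α b 0F * K (combine b 0F) (combine b s) + point α b 1F * K (combine b 1F) (combine b s)
      ≈⟨ +-cong (*-congˡ (K-same b 0F s)) (*-congˡ (K-same b 1F s)) ⟩
    point α b 0F * J 0F s + point α b 1F * J 1F s ∎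

  -- Only entries inside one block survive: the columns of `J` turn the pair `(x , y)` into
  -- `(- y , x)`.
  ⟨⟩≈ω : ∀ α β → ⟨ α , β ⟩ ≈ ω (point α) (point β)
  ⟨⟩≈ω α β = begin
    ⟨ α , β ⟩
      ≈⟨ sum-pairs ν (λ j → ∑[ i < ν ℕ.* 2 ] (α i * K i j) * β j) ⟩
    ∑[ b < ν ] (∑[ i < ν ℕ.* 2 ] (α i * K i (combine b 0F)) * β (combine b 0F)
              + ∑[ i < ν ℕ.* 2 ] (α i * K i (combine b 1F)) * β (combine b 1F))
      ≈⟨ sum-cong-≋ {ν} (λ b → trans (+-cong (*-congʳ (column₀ b)) (*-congʳ (column₁ b)))
           (trans (+-comm _ _) (+-congˡ (sym (-‿distribˡ-* _ _))))) ⟩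
    ω (point α) (point β) ∎
    where
    column₀ : ∀ b → ∑[ i < ν ℕ.* 2 ] (α i * K i (combine b 0F)) ≈ - point α b 1F
    column₀ b = trans (row α b 0F) (trans (+-cong (zeroʳ _)
      (trans (sym (-‿distribʳ-* _ _)) (-‿cong (*-identityʳ _)))) (+-identityˡ _))
    column₁ : ∀ b → ∑[ i < ν ℕ.* 2 ] (α i * K i (combine b 1F)) ≈ point α b 0F
    column₁ b = trans (row α b 1F) (trans (+-cong (*-identityʳ _) (zeroʳ _)) (+-identityʳ _))

-- The lower bound: counting vectors by colour class.

module LowerBound {ℓ₁ ℓ₂} (F : HeytingField c ℓ₁ ℓ₂) (ν : ℕ)
  {q-2 : ℕ} (card : HasCardinality (fieldSetoid F) (suc (suc q-2))) where
  private
    q : ℕ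
    q = suc (suc q-2)

  open Symplectic F ν
  open SymplecticForm F ν
  open CommutativeRing (fieldRing F) hiding (zero)
  open AlternatingForm (fieldRing F)
  open FiniteField (fieldRing F) (inverse F card) card using (_≈?_; vectors)
  open Isotropic (fieldRing F) (inverse F card) card

  N = q ℕ.^ (ν ℕ.* 2)

  vec : Fin N → RowVector
  vec = Inverse.from (vectors (ν ℕ.* 2))

  module _ {k} (f : Func lines (≡.setoid (Fin k)))
    (proper : ∀ {x y} → Adjacent x y → ¬ Func.to f x ≡ Func.to f y) where

    ZeroVector : RowVector → Set ℓ₁
    ZeroVector α = ∀ i → α i ≈ 0#

    zero? : ∀ α → Dec (ZeroVector α)
    zero? α = Fin.all? (λ i → α i ≈? 0#)

    -- The zero vector spans no line and gets `nothing`.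
    colour : ∀ α → Dec (ZeroVector α) → Maybe (Fin k)
    colour α (yes _)  = nothing
    colour α (no α≉0) = just (Func.to f (α , α≉0))

    colourOf : Fin N → Maybe (Fin k)
    colourOf i = colour (vec i) (zero? (vec i))

    coloured-nonzero : ∀ {α c} (d : Dec (ZeroVector α)) → colour α d ≡ just c → NonZeroVector α
    coloured-nonzero (no α≉0) _ = α≉0

    same-colour-orthogonal : ∀ {α β c} (d : Dec (ZeroVector α)) (d′ : Dec (ZeroVector β)) →
      colour α d ≡ just c → colour β d′ ≡ just c → ⟨ α , β ⟩ ≈ 0#
    same-colour-orthogonal {α} {β} (no α≉0) (no β≉0) eq eq′ =
      decidable-stable (⟨ α , β ⟩ ≈? 0#) (λ adj → proper {α , α≉0} {β , β≉0} adj
        (just-injective (≡.trans eq (≡.sym eq′))))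

    -- Vectors outside the class are replaced by zero, which is orthogonal to everything; so each
    -- class is a family over the same index set and contains zero at `origin`.
    member : ∀ c i → Dec (colourOf i ≡ just c) → Point ν
    member c i (yes _) = point (vec i)
    member c i (no _)  = λ _ _ → 0#

    members : Fin k → Fin N → Point ν
    members c i = member c i (≡-dec Fin._≟_ (colourOf i) (just c))

    members-orthogonal : ∀ c i j → ω (members c i) (members c j) ≈ 0#
    members-orthogonal c i j = go (≡-dec Fin._≟_ (colourOf i) (just c)) (≡-dec Fin._≟_ (colourOf j) (just c))
      where
      go : ∀ d d′ → ω (member c i d) (member c j d′) ≈ 0#
      go (yes eq) (yes eq′) = trans (sym (⟨⟩≈ω (vec i) (vec j)))
        (same-colour-orthogonal (zero? (vec i)) (zero? (vec j)) eq eq′)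
      go (no _)   d′        = ω-zeroˡ (λ _ _ → 0#) (member c j d′) (λ _ _ → refl)
      go (yes eq) (no _)    = ω-zeroʳ (point (vec i)) (λ _ _ → 0#) (λ _ _ → refl)

    members-≡ : ∀ {c i} → colourOf i ≡ just c → members c i ≡ point (vec i)
    members-≡ {c} {i} eq = go (≡-dec Fin._≟_ (colourOf i) (just c))
      where
      go : ∀ d → member c i d ≡ point (vec i)
      go (yes _) = ≡.refl
      go (no ≢)  = contradiction eq ≢

    origin : Fin N
    origin = Inverse.to (vectors (ν ℕ.* 2)) (λ _ → 0#)

    origin-zero : ∀ i → vec origin i ≈ 0#
    origin-zero = Inverse.strictlyInverseʳ (vectors (ν ℕ.* 2)) (λ _ → 0#)

    members-origin : ∀ c b s → members c origin b s ≈ 0#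
    members-origin c b s = go (≡-dec Fin._≟_ (colourOf origin) (just c))
      where
      go : ∀ d → member c origin d b s ≈ 0#
      go (yes _) = origin-zero (combine b s)
      go (no _)  = refl

    point-injective : ∀ α β → (∀ b s → point α b s ≈ point β b s) → ∀ i → α i ≈ β i
    point-injective α β eq i = ≡.subst (λ i → α i ≈ β i) (Fin.combine-remQuot {ν} 2 i)
      (eq (proj₁ (remQuot {ν} 2 i)) (proj₂ (remQuot {ν} 2 i)))

    module _ {Q-1} (q^ν≡ : q ℕ.^ ν ≡ suc Q-1) where

      codes : ∀ c → ∃[ code ] Separates {Q = suc Q-1} (members c) code
      codes c = ≡.subst (λ Q → ∃[ code ] Separates {Q = Q} (members c) code) q^ν≡
        (isotropic-code ν (members c) (members-orthogonal c))

      code : Fin k → Fin N → Fin (suc Q-1)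
      code c = proj₁ (codes c)

      -- A code shared with the origin would force the vector to be zero, but coloured vectors are
      -- nonzero.
      code-nonorigin : ∀ {c i} → colourOf i ≡ just c → code c origin ≢ code c i
      code-nonorigin {c} {i} eq code≡ = coloured-nonzero (zero? (vec i)) eq
        (point-injective (vec i) (λ _ → 0#) (λ b s →
          trans (reflexive (≡.cong (λ u → u b s) (≡.sym (members-≡ eq))))
          (trans (sym (proj₂ (codes c) origin i code≡ b s)) (members-origin c b s))))

      -- The origin uses up one code in every class, leaving Q-1 for the nonzero vectors.
      label : ∀ i (x : Maybe (Fin k)) → colourOf i ≡ x → Fin (suc (k ℕ.* Q-1))
      label i nothing  _  = zero
      label i (just c) eq = suc (combine c (punchOut (code-nonorigin eq)))

      uncoloured-zero : ∀ α d → colour α d ≡ nothing → ZeroVector α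
      uncoloured-zero α (yes α≈0) _ = α≈0

      label-injective : ∀ i j x y (p : colourOf i ≡ x) (p′ : colourOf j ≡ y) →
                        label i x p ≡ label j y p′ → i ≡ j
      label-injective i j nothing nothing p p′ _ = Finite.from-injective (vectors (ν ℕ.* 2))
        (λ b → trans (uncoloured-zero (vec i) (zero? (vec i)) p b)
                     (sym (uncoloured-zero (vec j) (zero? (vec j)) p′ b)))
      label-injective i j (just c) (just c′) p p′ eq
        with ≡.refl ← Fin.combine-injectiveˡ c _ c′ _ (Fin.suc-injective eq) =
        Finite.from-injective (vectors (ν ℕ.* 2)) (point-injective (vec i) (vec j) (λ b s →
          trans (reflexive (≡.cong (λ u → u b s) (≡.sym (members-≡ p))))
          (trans (proj₂ (codes c) i j (Fin.punchOut-injective (code-nonorigin p) (code-nonorigin p′)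
                    (Fin.combine-injectiveʳ c _ c _ (Fin.suc-injective eq))) b s)
                 (reflexive (≡.cong (λ u → u b s) (members-≡ p′))))))

      vectors-bound : N ℕ.≤ suc (k ℕ.* Q-1)
      vectors-bound = Fin.injective⇒≤ {f = λ i → label i (colourOf i) ≡.refl}
        (λ {i} {j} → label-injective i j (colourOf i) (colourOf j) ≡.refl ≡.refl)

  colours-bound : 1 ℕ.≤ ν → ∀ k → Colourable Sp k → q ℕ.^ ν ℕ.+ 1 ℕ.≤ k
  colours-bound 1≤ν k (f , proper) = bound (q ℕ.^ ν) ≡.refl 2≤q^ν
    where
    2≤q^ν : 2 ℕ.≤ q ℕ.^ ν
    2≤q^ν = ℕ.≤-trans (ℕ.s≤s (ℕ.s≤s ℕ.z≤n)) (base≤power q 1≤ν)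
    bound : ∀ Q → q ℕ.^ ν ≡ Q → 2 ℕ.≤ Q → Q ℕ.+ 1 ℕ.≤ k
    bound Q@(suc Q-1) q^ν≡ 2≤Q = ℕ.≮⇒≥ λ k<Q+1 → ℕ.<⇒≱ (few k<Q+1) (vectors-bound f proper q^ν≡)
      where
      -- With at most `Q` colours the labels number at most `1 + Q * (Q - 1)`, which is less than
      -- `Q * Q` because `Q` is at least 2.
      few : k ℕ.< Q ℕ.+ 1 → suc (k ℕ.* Q-1) ℕ.< N
      few k<Q+1 = begin-strict
        suc (k ℕ.* Q-1)        ≤⟨ ℕ.s≤s (ℕ.*-monoˡ-≤ Q-1 (ℕ.≤-pred (≡.subst (k ℕ.<_) (ℕ.+-comm Q 1) k<Q+1))) ⟩
        suc (Q ℕ.* Q-1)        <⟨ ℕ.+-monoˡ-< (Q ℕ.* Q-1) 2≤Q ⟩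
        Q ℕ.+ Q ℕ.* Q-1        ≡⟨ ℕ.*-suc Q Q-1 ⟨
        Q ℕ.* Q                ≡⟨ ≡.cong (Q ℕ.*_) (ℕ.*-identityʳ Q) ⟨
        Q ℕ.^ 2                ≡⟨ ≡.cong (ℕ._^ 2) q^ν≡ ⟨
        (q ℕ.^ ν) ℕ.^ 2        ≡⟨ ℕ.^-*-assoc q ν 2 ⟩
        N                      ∎
        where open ℕ.≤-Reasoning

-- The upper bound: colouring by a symplectic spread.

module SpreadColouring {ℓ₁ ℓ₂} (F : HeytingField c ℓ₁ ℓ₂) (ν : ℕ)
  {q-2 : ℕ} (card : HasCardinality (fieldSetoid F) (suc (suc q-2)))
  (spread : SpreadSet (fieldRing F) ν) where
  private
    q : ℕ
    q = suc (suc q-2)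

  open Symplectic F ν
  open SymplecticForm F ν
  open CommutativeRing (fieldRing F) hiding (zero)
  open SemiringSum semiring
  open Sums (fieldRing F)
  open AlternatingForm (fieldRing F)
  open FiniteField (fieldRing F) (inverse F card) card using (_≈?_; vectors)
  open SpreadSet spread
  open ≈-Reasoning setoid

  Colour : Set
  Colour = Fin (q ℕ.^ ν ℕ.+ 1)

  first second : RowVector → Vector Carrier ν
  first  α b = point α b 0F
  second α b = point α b 1F

  apply : Vector Carrier ν → Vector Carrier ν → Vector Carrier ν
  apply v x i = ∑[ j < ν ] (matrix v i j * x j)

  -- Colours are slopes: the graph of `matrix v` has slope `v`, and the subspace with `first` equal
  -- to zero has infinite slope.
  finite : Vector Carrier ν → Colour
  finite v = Inverse.to (vectors ν) v ↑ˡ 1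

  infinite : Colour
  infinite = (q ℕ.^ ν) ↑ʳ 0F

  finite≢infinite : ∀ v → finite v ≢ infinite
  finite≢infinite v eq = contradiction
    (≡.trans (≡.sym (Fin.splitAt-↑ˡ (q ℕ.^ ν) (Inverse.to (vectors ν) v) 1))
      (≡.trans (≡.cong (splitAt (q ℕ.^ ν)) eq) (Fin.splitAt-↑ʳ (q ℕ.^ ν) 1 0F))) λ ()

  -- A relation instead of a function, so that invariance and properness need not follow the
  -- decision made in `colouring`.
  IsColour : RowVector → Colour → Set (c ⊔ ℓ₁)
  IsColour α x = ((∀ i → first α i ≈ 0#) ∧ x ≡ infinite) ⊎
    ((¬ (∀ i → first α i ≈ 0#)) ∧ (∃[ v ] (∀ i → apply v (first α) i ≈ second α i) ∧ x ≡ finite v))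

  -- For a nonzero first half, `v ↦ apply v (first α)` is injective on a finite set, hence hits
  -- `second α`.
  colouring : ∀ α → ∃[ x ] IsColour α x
  colouring α with Fin.all? (λ i → first α i ≈? 0#)
  ... | yes α≈0 = infinite , inj₁ (α≈0 , ≡.refl)
  ... | no  α≉0 with v , eq ← Finite.injective⇒surjective (vectors ν) (λ v → apply v (first α))
                                (λ {u} {v} → injective (first α) α≉0 u v) (second α)
    = finite v , inj₂ (α≉0 , v , eq , ≡.refl)

  scale-zero : ∀ {α β} t → (∀ i → β i ≈ t * α i) → (∀ i → first α i ≈ 0#) → ∀ i → first β i ≈ 0#
  scale-zero t β≈tα α≈0 i = trans (β≈tα _) (trans (*-congˡ (α≈0 i)) (zeroʳ t))

  scale-apply : ∀ {α β} t → (∀ i → β i ≈ t * α i) → ∀ v →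
                (∀ i → apply v (first α) i ≈ second α i) → ∀ i → apply v (first β) i ≈ second β i
  scale-apply {α} {β} t β≈tα v eq i = begin
    ∑[ j < ν ] (matrix v i j * first β j)         ≈⟨ sum-cong-≋ {ν} (λ j → trans (*-congˡ (β≈tα _))
      (trans (sym (*-assoc _ _ _)) (trans (*-congʳ (*-comm _ t)) (*-assoc _ _ _)))) ⟩
    ∑[ j < ν ] (t * (matrix v i j * first α j))   ≈⟨ *-distribˡ-sum {ν} t _ ⟨
    t * apply v (first α) i                       ≈⟨ *-congˡ (eq i) ⟩
    t * second α i                                ≈⟨ β≈tα _ ⟨
    second β i                                    ∎

  -- Scalars in both directions let vanishing of `first` pass each way. In the finite case both
  -- matrices send `first β` to `second β`, so injectivity identifies `u` and `v`.
  proportional⇒≡ : ∀ {α β x y} s t → (∀ i → α i ≈ s * β i) → (∀ i → β i ≈ t * α i) →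
                   IsColour α x → IsColour β y → x ≡ y
  proportional⇒≡ s t α≈sβ β≈tα (inj₁ (_ , x≡)) (inj₁ (_ , y≡)) = ≡.trans x≡ (≡.sym y≡)
  proportional⇒≡ s t α≈sβ β≈tα (inj₁ (α≈0 , _)) (inj₂ (β≉0 , _)) = contradiction (scale-zero t β≈tα α≈0) β≉0
  proportional⇒≡ s t α≈sβ β≈tα (inj₂ (α≉0 , _)) (inj₁ (β≈0 , _)) = contradiction (scale-zero s α≈sβ β≈0) α≉0
  proportional⇒≡ {α} {β} s t α≈sβ β≈tα (inj₂ (_ , u , u≈ , x≡)) (inj₂ (β≉0 , v , v≈ , y≡)) =
    ≡.trans x≡ (≡.trans (≡.cong (_↑ˡ 1) (Inverse.to-cong (vectors ν) {u} {v} (injective (first β) β≉0 u v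
      (λ i → trans (scale-apply {α} {β} t β≈tα u u≈ i) (sym (v≈ i)))))) (≡.sym y≡))

  -- The graph of a symmetric matrix is totally isotropic: both halves of the form become the same
  -- double sum after transposing the matrix.
  same-colour-orthogonal : ∀ {α β x} → IsColour α x → IsColour β x → ω (point α) (point β) ≈ 0#
  same-colour-orthogonal (inj₁ (α≈0 , _)) (inj₁ (β≈0 , _)) = sum-zero {ν} _ (λ b →
    0-0≈0 (trans (*-congʳ (α≈0 b)) (zeroˡ _)) (trans (*-congˡ (β≈0 b)) (zeroʳ _)))
  same-colour-orthogonal (inj₁ (_ , x≡∞)) (inj₂ (_ , v , _ , x≡v)) =
    contradiction (≡.trans (≡.sym x≡v) x≡∞) (finite≢infinite v)
  same-colour-orthogonal (inj₂ (_ , v , _ , x≡v)) (inj₁ (_ , x≡∞)) =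
    contradiction (≡.trans (≡.sym x≡v) x≡∞) (finite≢infinite v)
  same-colour-orthogonal {α} {β} (inj₂ (_ , u , u≈ , x≡u)) (inj₂ (_ , v , v≈ , x≡v)) = begin
    ω (point α) (point β)
      ≈⟨ sum-minus {ν} _ _ ⟩
    ∑[ i < ν ] (first α i * second β i) - ∑[ i < ν ] (second α i * first β i)
      ≈⟨ x≈y⇒x-y≈0 (trans left (sym right)) ⟩
    0# ∎
    where
    u≈v : ∀ i → v i ≈ u i
    u≈v = Finite.to-injective (vectors ν) {v} {u} (Fin.↑ˡ-injective 1 _ _ (≡.trans (≡.sym x≡v) x≡u))
    left : ∑[ i < ν ] (first α i * second β i) ≈ ∑[ i < ν ] ∑[ j < ν ] (first α i * (matrix u i j * first β j))
    left = sum-cong-≋ {ν} (λ i → trans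
      (*-congˡ (trans (sym (v≈ i)) (sum-cong-≋ {ν} (λ j → *-congʳ (matrix-cong u≈v i j)))))
      (*-distribˡ-sum {ν} (first α i) _))
    right : ∑[ j < ν ] (second α j * first β j) ≈ ∑[ i < ν ] ∑[ j < ν ] (first α i * (matrix u i j * first β j))
    right = begin
      ∑[ j < ν ] (second α j * first β j)
        ≈⟨ sum-cong-≋ {ν} (λ j → trans (*-congʳ (sym (u≈ j))) (*-distribʳ-sum {ν} (first β j) _)) ⟩
      ∑[ j < ν ] ∑[ i < ν ] (matrix u j i * first α i * first β j)
        ≈⟨ ∑-comm {ν} {ν} _ ⟩
      ∑[ i < ν ] ∑[ j < ν ] (matrix u j i * first α i * first β j)
        ≈⟨ sum-cong-≋ {ν} (λ i → sum-cong-≋ {ν} (λ j → trans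
             (*-congʳ (trans (*-comm _ _) (*-congˡ (symmetric u j i)))) (*-assoc _ _ _))) ⟩
      ∑[ i < ν ] ∑[ j < ν ] (first α i * (matrix u i j * first β j)) ∎

  self∈Span : ∀ α → Span α α
  self∈Span α = 1# , λ i → sym (*-identityˡ (α i))

  colourable : Colourable Sp (q ℕ.^ ν ℕ.+ 1)
  colourable = record
    { to   = λ (α , _) → proj₁ (colouring α)
    ; cong = λ { {α , _} {β , _} (α⊆β , β⊆α) →
        let s , α≈sβ = α⊆β (self∈Span α)
            t , β≈tα = β⊆α (self∈Span β)
        in proportional⇒≡ s t α≈sβ β≈tα (proj₂ (colouring α)) (proj₂ (colouring β)) }
    } , λ { {α , _} {β , _} adj eq → adj (trans (⟨⟩≈ω α β) (same-colour-orthogonal {α} {β}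
        (proj₂ (colouring α)) (≡.subst (IsColour β) (≡.sym eq) (proj₂ (colouring β))))) }

-- The chromatic number.

symplectic-chromatic : ∀ {c ℓ₁ ℓ₂} {q p k} → Prime p → q ≡ p ℕ.^ k → 2 ℕ.≤ q →
  (F : HeytingField c ℓ₁ ℓ₂) → HasCardinality (fieldSetoid F) q →
  ∀ ν → 1 ℕ.≤ ν → IsChromaticNumber (Symplectic.Sp F ν) (q ℕ.^ ν ℕ.+ 1)
symplectic-chromatic {q = q@(suc (suc _))} {k = k} p-prime q≡p^k (ℕ.s≤s (ℕ.s≤s _)) F card ν@(suc ν-1) 1≤ν =
  SpreadColouring.colourable F ν card (spread primitiveIdempotent) , LowerBound.colours-bound F ν card 1≤ν
  where
  s : ℕ
  -- Chosen so that the cyclic group has order `suc s`, which is `q ^ ν - 1`.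
  s = q ℕ.^ ν ℕ.∸ 2
  q^ν≡2+s : q ℕ.^ ν ≡ suc (suc s)
  q^ν≡2+s = ≡.sym (ℕ.m+[n∸m]≡n (ℕ.≤-trans (ℕ.s≤s (ℕ.s≤s ℕ.z≤n)) (base≤power q 1≤ν)))
  open CyclicAlgebra (fieldRing F) (inverse F card) card {k = k} p-prime q≡p^k ν-1 q^ν≡2+s
  spread : ∃ IsPrimitive → SpreadSet (fieldRing F) ν
  spread (e , e-primitive) = Spread.spreadSet e e-primitive

open import Data.Nat.Base using (_+_; _^_; _≤_)

theorem2p4 : ∀ {c ℓ₁ ℓ₂} (q : ℕ) → IsPrimePower q →
    (F : HeytingField c ℓ₁ ℓ₂) → HasCardinality (fieldSetoid F) q →
    (ν : ℕ) → 1 ≤ ν →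
    IsChromaticNumber (Symplectic.Sp F ν) (q ^ ν + 1)
theorem2p4 q (p , k , p-prime , 1≤k , ≡.refl) = symplectic-chromatic {k = k} p-prime ≡.refl
  -- `2 ≤ p ≤ p ^ k`, the second inequality by `1 ≤ k`.
  (ℕ.≤-trans (ℕ.nonTrivial⇒n>1 p {{prime⇒nonTrivial p-prime}})
             (base≤power p {{prime⇒nonZero p-prime}} 1≤k))
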